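{- Let $k\ge 1$ be an integer and let $G$ be a finite simple graph that is claw-free and minimal $k$-factor-critical. Then the minimum degree of $G$ satisfies $\delta(G)=k+1$.
   Context: A graph $G$ of order $n$ is $k$-factor-critical (for an integer $1\le k<n$) if for every set $X$ of $k$ vertices, $G-X$ has a perfect matching. A $k$-factor-critical graph $G$ is minimal if for every edge $e$ of $G$, the graph $G-e$ is not $k$-factor-critical. A graph is claw-free if it has no induced subgraph isomorphic to $K_{1,3}$. $\delta(G)$ denotes the minimum vertex degree of $G$. -}

module Defs where

open import Data.Nat using (ℕ; _<_; _≤_; suc)
open import Data.Fin using (Fin)
open import Data.Bool using (Bool; true; false; if_then_else_; _∧_)
open import Data.Fin.Subset using (Subset; _∈_; _∉_; ∣_∣)
open import Data.Vec using (tabulate)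
open import Data.Product using (Σ; ∃; _×_; _,_)
open import Relation.Binary.PropositionalEquality using (_≡_; _≢_)
open import Relation.Nullary using (¬_; Dec; yes; no)
open import Data.Fin using (_≟_)

record Graph (n : ℕ) : Set where
  field
    adj   : Fin n → Fin n → Bool
    sym   : ∀ u v → adj u v ≡ adj v u
    irrefl : ∀ v → adj v v ≡ false
open Graph public

Adj : ∀ {n} → Graph n → Fin n → Fin n → Set
Adj G u v = adj G u v ≡ true

nbhd : ∀ {n} → Graph n → Fin n → Subset n
nbhd G v = tabulate (λ u → adj G v u)

degree : ∀ {n} → Graph n → Fin n → ℕ
degree G v = ∣ nbhd G v ∣

MinDegreeIs : ∀ {n} → Graph n → ℕ → Set
MinDegreeIs G d = (∀ v → d ≤ degree G v) × ∃ (λ v → degree G v ≡ d)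

isEnd : ∀ {n} → Fin n → Fin n → Fin n → Bool
isEnd a b u with u ≟ a | u ≟ b
... | yes _ | _ = true
... | no _ | yes _ = true
... | no _ | no _ = false

deleteEdge : ∀ {n} (G : Graph n) (a b : Fin n) → Adj G a b → Graph n
deleteEdge {n} G a b _ = record
  { adj = λ u v → if (isEnd a b u ∧ isEnd a b v) then false else adj G u v
  ; sym = symm
  ; irrefl = irr
  }
  where
    open import Data.Bool.Properties using (∧-comm)
    open import Relation.Binary.PropositionalEquality using (cong₂; refl)
    symm : ∀ u v → (if (isEnd a b u ∧ isEnd a b v) then false else adj G u v)
                 ≡ (if (isEnd a b v ∧ isEnd a b u) then false else adj G v u)
    symm u v = cong₂ (λ c x → if c then false else x) (∧-comm (isEnd a b u) (isEnd a b v)) (Graph.sym G u v)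
    irr : ∀ v → (if (isEnd a b v ∧ isEnd a b v) then false else adj G v v) ≡ false
    irr v with isEnd a b v ∧ isEnd a b v
    ... | true = refl
    ... | false = Graph.irrefl G v

-- A perfect matching of G - X, given as a fixed-point-free involution
-- (partner function) on the vertices outside X, along edges of G.
PerfectMatchingAvoiding : ∀ {n} → Graph n → Subset n → Set
PerfectMatchingAvoiding {n} G X =
  Σ (Fin n → Fin n) λ p →
    ∀ v → v ∉ X → (p v ∉ X) × Adj G v (p v) × (p (p v) ≡ v)

FactorCritical : ∀ {n} → ℕ → Graph n → Set
FactorCritical {n} k G =
  (1 ≤ k) × (k < n) × (∀ (X : Subset n) → ∣ X ∣ ≡ k → PerfectMatchingAvoiding G X)

MinimalFactorCritical : ∀ {n} → ℕ → Graph n → Set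
MinimalFactorCritical {n} k G =
  FactorCritical k G ×
  (∀ (a b : Fin n) (e : Adj G a b) → ¬ FactorCritical k (deleteEdge G a b e))

ClawFree : ∀ {n} → Graph n → Set
ClawFree {n} G =
  ∀ (v a b c : Fin n) →
    Adj G v a → Adj G v b → Adj G v c →
    a ≢ b → a ≢ c → b ≢ c →
    ¬ (¬ Adj G a b × ¬ Adj G a c × ¬ Adj G b c)

{-# OPTIONS --safe #-}
module Submission where

-- Suppose all degrees exceed k + 1.  Call an edge uv fragile if some X with |X| ≤ k separates u from v in G − uv.
--
-- In a claw-free graph two exposed vertices of a matching that are joined by a walk can always be matched, by moving
-- one of them along the walk.  Let M be a perfect matching of G − X, |X| = k, that uses uz.  Only the claws of G − uz
-- centred at a common neighbour y of u and z can stop M − uz from being augmented.  If they do, y together with X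
-- separates the partner of y from u and z, and one obtains a barrier T with |T| ≤ k + 1 whose vertices see the side P
-- of u, the side Q of z and a third component.  If uz is not fragile, claw-freeness forces every vertex of T to meet
-- P and Q in u and z only.  A neighbour v of u that is not adjacent to z then lies in P, so u is a cut vertex and
-- k = 1; comparing this barrier with one for an edge from u to T refutes that case by parity.  Hence, by minimality
-- of G, every edge uz with such a v is fragile.
--
-- Take a fragile edge uv with the side F of u smallest.  As u has degree at least k + 2, it has a neighbour z in F,
-- v is not adjacent to z, so uz is fragile as well, and uncrossing the two separations yields a smaller side.

open import Defs
open import Data.Nat using (ℕ; zero; suc; _+_; _≤_; _<_; z≤n; s≤s; parity)
open import Data.Nat.Properties hiding (suc-injective) renaming (_≟_ to _≟ℕ_)
open import Data.Bool using (Bool; true; false; if_then_else_; _∧_)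
open import Data.Bool.Properties using () renaming (_≟_ to _≟ᵇ_)
open import Data.Fin using (Fin; zero; suc; _≟_)
open import Data.Fin.Properties using (any?; suc-injective)
open import Data.Fin.Subset using (Subset; ∣_∣)
open import Data.Parity using (0ℙ; 1ℙ)
open import Data.Parity.Properties using (+-homo-+)
open import Data.Vec using ([]; _∷_; lookup; tabulate)
open import Data.Vec.Properties using (lookup⇒[]=; []=⇒lookup; lookup∘tabulate)
open import Data.Product using (Σ; ∃; _×_; _,_; proj₁; proj₂)
open import Data.Sum using (_⊎_; inj₁; inj₂; swap; [_,_]′)
open import Data.Empty using (⊥; ⊥-elim)
open import Data.Unit using (⊤; tt)
open import Function using (_∘_; id)
open import Relation.Nullary using (¬_; Dec; yes; no; does)
open import Relation.Nullary.Decidable using (_×-dec_; _⊎-dec_; ¬?)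
open import Relation.Binary.PropositionalEquality using (_≡_; _≢_; refl; cong; cong₂; subst; trans) renaming (sym to ≡-sym)

-- Finite vertex sets and counting

record VSet (n : ℕ) : Set₁ where
  field
    Mem  : Fin n → Set
    mem? : ∀ v → Dec (Mem v)
open VSet

infix 4 _∈_ _∉_

_∈_ _∉_ : ∀ {n} → Fin n → VSet n → Set
v ∈ A = Mem A v
v ∉ A = ¬ Mem A v

full : ∀ {n} → VSet n
full = record { Mem = λ _ → ⊤ ; mem? = λ _ → yes tt }

⁅_⁆ : ∀ {n} → Fin n → VSet n
⁅ x ⁆ = record { Mem = _≡ x ; mem? = _≟ x }

∁ : ∀ {n} → VSet n → VSet n
∁ A = record { Mem = λ v → ¬ Mem A v ; mem? = λ v → ¬? (mem? A v) }

infixr 7 _∩_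
infixr 6 _∪_
infixl 8 _∖_

_∩_ _∪_ _∖_ : ∀ {n} → VSet n → VSet n → VSet n
A ∩ B = record { Mem = λ v → Mem A v × Mem B v ; mem? = λ v → mem? A v ×-dec mem? B v }
A ∪ B = record { Mem = λ v → Mem A v ⊎ Mem B v ; mem? = λ v → mem? A v ⊎-dec mem? B v }
A ∖ B = A ∩ ∁ B

ind : ∀ {P : Set} → Dec P → ℕ
ind d = if does d then 1 else 0

ind-mono : ∀ {P Q : Set} (p : Dec P) (q : Dec Q) → (P → Q) → ind p ≤ ind q
ind-mono (no _)  q       f = z≤n
ind-mono (yes p) (yes q) f = ≤-refl
ind-mono (yes p) (no ¬q) f = ⊥-elim (¬q (f p))

sumFin : ∀ {n} → (Fin n → ℕ) → ℕ
sumFin {zero}  f = 0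
sumFin {suc n} f = f zero + sumFin (f ∘ suc)

sumFin-mono : ∀ {n} {f g : Fin n → ℕ} → (∀ v → f v ≤ g v) → sumFin f ≤ sumFin g
sumFin-mono {zero}  h = z≤n
sumFin-mono {suc n} h = +-mono-≤ (h zero) (sumFin-mono (h ∘ suc))

interchange : ∀ a b c d → (a + b) + (c + d) ≡ (a + c) + (b + d)
interchange a b c d = trans (+-assoc a b (c + d)) (trans (cong (a +_) (trans (≡-sym (+-assoc b c d))
  (trans (cong (_+ d) (+-comm b c)) (+-assoc c b d)))) (≡-sym (+-assoc a c (b + d))))

sumFin-+ : ∀ {n} (f g : Fin n → ℕ) → sumFin (λ v → f v + g v) ≡ sumFin f + sumFin g
sumFin-+ {zero}  f g = refl
sumFin-+ {suc n} f g = trans (cong (f zero + g zero +_) (sumFin-+ (f ∘ suc) (g ∘ suc)))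
  (interchange (f zero) (g zero) (sumFin (f ∘ suc)) (sumFin (g ∘ suc)))

chi : ∀ {n} → VSet n → Fin n → ℕ
chi A v = ind (mem? A v)

count : ∀ {n} → VSet n → ℕ
count A = sumFin (chi A)

count-mono : ∀ {n} (A B : VSet n) → (∀ v → v ∈ A → v ∈ B) → count A ≤ count B
count-mono A B h = sumFin-mono (λ v → ind-mono (mem? A v) (mem? B v) (h v))

count-∪-≤ : ∀ {n} (A B C : VSet n) → (∀ v → v ∈ A → v ∈ B ⊎ v ∈ C) → count A ≤ count B + count C
count-∪-≤ A B C h = ≤-trans (sumFin-mono pointwise) (≤-reflexive (sumFin-+ (chi B) (chi C)))
  where
  pointwise : ∀ v → chi A v ≤ chi B v + chi C v
  pointwise v with mem? A v | mem? B v | mem? C v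
  ... | no _  | _     | _     = z≤n
  ... | yes _ | yes _ | _     = s≤s z≤n
  ... | yes _ | no _  | yes _ = s≤s z≤n
  ... | yes a | no ¬b | no ¬c = ⊥-elim ([ ¬b , ¬c ]′ (h v a))

count-⊎ : ∀ {n} (A B C : VSet n) → (∀ v → v ∈ A → v ∈ B ⊎ v ∈ C) → (∀ v → v ∈ B → v ∈ A) →
  (∀ v → v ∈ C → v ∈ A) → (∀ v → v ∈ B → v ∉ C) → count A ≡ count B + count C
count-⊎ A B C h B⊆A C⊆A disj = ≤-antisym (count-∪-≤ A B C h)
  (≤-trans (≤-reflexive (≡-sym (sumFin-+ (chi B) (chi C)))) (sumFin-mono pointwise))
  where
  pointwise : ∀ v → chi B v + chi C v ≤ chi A v
  pointwise v with mem? A v | mem? B v | mem? C v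
  ... | _     | yes b | yes c = ⊥-elim (disj v b c)
  ... | _     | no _  | no _  = z≤n
  ... | yes _ | yes _ | no _  = ≤-refl
  ... | yes _ | no _  | yes _ = ≤-refl
  ... | no ¬a | yes b | no _  = ⊥-elim (¬a (B⊆A v b))
  ... | no ¬a | no _  | yes c = ⊥-elim (¬a (C⊆A v c))

sumFin-zero : ∀ {n} (f : Fin n → ℕ) → (∀ v → f v ≡ 0) → sumFin f ≡ 0
sumFin-zero {zero}  f h = refl
sumFin-zero {suc n} f h = cong₂ _+_ (h zero) (sumFin-zero (f ∘ suc) (h ∘ suc))

count-empty : ∀ {n} (A : VSet n) → (∀ v → v ∉ A) → count A ≡ 0
count-empty A h = sumFin-zero (chi A) (λ v → pointwise v (mem? A v))
  where
  pointwise : ∀ v (d : Dec (v ∈ A)) → ind d ≡ 0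
  pointwise v (yes a) = ⊥-elim (h v a)
  pointwise v (no _)  = refl

count-⁅⁆ : ∀ {n} (x : Fin n) → count ⁅ x ⁆ ≡ 1
count-⁅⁆ {suc n} zero = cong suc (count-empty {n} (record { Mem = λ v → suc v ≡ zero ; mem? = λ v → suc v ≟ zero }) (λ v ()))
count-⁅⁆ (suc x) = trans (≤-antisym (count-mono shifted ⁅ x ⁆ (λ v → suc-injective))
                                    (count-mono ⁅ x ⁆ shifted (λ v → cong suc))) (count-⁅⁆ x)
  where
  shifted : VSet _
  shifted = record { Mem = λ v → suc v ≡ suc x ; mem? = λ v → suc v ≟ suc x }

count-full : ∀ n → count (full {n}) ≡ n
count-full zero    = refl
count-full (suc n) = cong suc (count-full n)

count-remove : ∀ {n} (A : VSet n) x → x ∈ A → count A ≡ suc (count (A ∖ ⁅ x ⁆))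
count-remove A x x∈A = trans (count-⊎ A ⁅ x ⁆ (A ∖ ⁅ x ⁆) split (λ { v refl → x∈A }) (λ v → proj₁)
  (λ v v≡x q → proj₂ q v≡x)) (cong (_+ count (A ∖ ⁅ x ⁆)) (count-⁅⁆ x))
  where
  split : ∀ v → v ∈ A → v ∈ ⁅ x ⁆ ⊎ v ∈ A ∖ ⁅ x ⁆
  split v a with v ≟ x
  ... | yes e = inj₁ e
  ... | no ne = inj₂ (a , ne)

count-insert : ∀ {n} (A : VSet n) x → x ∉ A → count (A ∪ ⁅ x ⁆) ≡ suc (count A)
count-insert A x x∉A = trans (count-⊎ (A ∪ ⁅ x ⁆) A ⁅ x ⁆ (λ v → id) (λ v → inj₁) (λ v → inj₂)
  (λ { v a refl → x∉A a })) (trans (cong (count A +_) (count-⁅⁆ x)) (+-comm (count A) 1))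

count-positive : ∀ {n} (A : VSet n) x → x ∈ A → 1 ≤ count A
count-positive A x x∈A = ≤-trans (s≤s z≤n) (≤-reflexive (≡-sym (count-remove A x x∈A)))

inhabited : ∀ {n} (A : VSet n) {m} → suc m ≤ count A → ∃ λ v → v ∈ A
inhabited A lt with any? (mem? A)
... | yes p = p
... | no ¬p = ⊥-elim (n≮0 (≤-trans lt (≤-reflexive (count-empty A (λ v a → ¬p (v , a))))))

difference-inhabited : ∀ {n} (A U : VSet n) → count A < count U → ∃ λ v → v ∈ U ∖ A
difference-inhabited A U lt with any? (mem? (U ∖ A))
... | yes p = p
... | no ¬p = ⊥-elim (<⇒≱ lt (count-mono U A U⊆A))
  where
  U⊆A : ∀ v → v ∈ U → v ∈ A
  U⊆A v u with mem? A v
  ... | yes a = a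
  ... | no ¬a = ⊥-elim (¬p (v , u , ¬a))

enlarge : ∀ {n} (A U : VSet n) d → (∀ v → v ∈ A → v ∈ U) → d + count A ≤ count U →
  Σ (VSet n) λ B → (∀ v → v ∈ A → v ∈ B) × (∀ v → v ∈ B → v ∈ U) × count B ≡ d + count A
enlarge A U zero    A⊆U le = A , (λ v → id) , A⊆U , refl
enlarge A U (suc d) A⊆U le
  with difference-inhabited A U (≤-trans (s≤s (m≤n+m (count A) d)) le)
... | x , x∈U , x∉A
  with enlarge (A ∪ ⁅ x ⁆) U d (λ { v (inj₁ a) → A⊆U v a ; v (inj₂ refl) → x∈U })
         (≤-trans (≤-reflexive eq) le)
  where
  eq : d + count (A ∪ ⁅ x ⁆) ≡ suc d + count A
  eq = trans (cong (d +_) (count-insert A x x∉A)) (+-suc d (count A))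
... | B , A⊆B , B⊆U , c = B , (λ v a → A⊆B v (inj₁ a)) , B⊆U ,
  trans c (trans (cong (d +_) (count-insert A x x∉A)) (+-suc d (count A)))

superset-of-size : ∀ {n} (A U : VSet n) j → (∀ v → v ∈ A → v ∈ U) → count A ≤ j → j ≤ count U →
  Σ (VSet n) λ B → (∀ v → v ∈ A → v ∈ B) × (∀ v → v ∈ B → v ∈ U) × count B ≡ j
superset-of-size A U j A⊆U A≤j j≤U with m≤n⇒∃[o]m+o≡n A≤j
... | d , refl with enlarge A U d A⊆U (subst (_≤ count U) (+-comm (count A) d) j≤U)
...   | B , p , q , c = B , p , q , trans c (+-comm d (count A))

-- Conversions occur only at the border with `FactorCritical`; elsewhere `VSet` is preferred because
-- membership in unions and differences unfolds to plain sums and products.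
toSubset : ∀ {n} → VSet n → Subset n
toSubset A = tabulate (λ v → does (mem? A v))

∣tabulate∣ : ∀ {n} (f : Fin n → Bool) → ∣ tabulate f ∣ ≡ sumFin (λ v → if f v then 1 else 0)
∣tabulate∣ {zero}  f = refl
∣tabulate∣ {suc n} f with f zero
... | true  = cong suc (∣tabulate∣ (f ∘ suc))
... | false = ∣tabulate∣ (f ∘ suc)

∈-toSubset⁺ : ∀ {n} (A : VSet n) v → v ∈ A → Data.Fin.Subset._∈_ v (toSubset A)
∈-toSubset⁺ A v a = lookup⇒[]= v (toSubset A) (trans (lookup∘tabulate (λ w → does (mem? A w)) v) (yes-true (mem? A v)))
  where
  yes-true : (d : Dec (v ∈ A)) → does d ≡ true
  yes-true (yes _) = refl
  yes-true (no ¬a) = ⊥-elim (¬a a)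

∈-toSubset⁻ : ∀ {n} (A : VSet n) v → Data.Fin.Subset._∈_ v (toSubset A) → v ∈ A
∈-toSubset⁻ A v a = true-yes (mem? A v)
  (trans (≡-sym (lookup∘tabulate (λ w → does (mem? A w)) v)) ([]=⇒lookup a))
  where
  true-yes : (d : Dec (v ∈ A)) → does d ≡ true → v ∈ A
  true-yes (yes a) _  = a
  true-yes (no _)  ()

fromSubset : ∀ {n} → Subset n → VSet n
fromSubset X = record { Mem = λ v → lookup X v ≡ true ; mem? = λ v → lookup X v ≟ᵇ true }

count-fromSubset : ∀ {n} (X : Subset n) → count (fromSubset X) ≡ ∣ X ∣
count-fromSubset []          = refl
count-fromSubset (true ∷ X)  = cong suc (count-fromSubset X)
count-fromSubset (false ∷ X) = count-fromSubset X

-- Parity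

Even : ℕ → Set
Even m = parity m ≡ 0ℙ

even-+ : ∀ a b → Even a → Even b → Even (a + b)
even-+ a b ea eb rewrite +-homo-+ a b | ea | eb = refl

even-suc-odd : ∀ a → Even a → ¬ Even (suc a)
even-suc-odd a ea esa with trans (≡-sym esa) (trans (+-homo-+ 1 a) (cong (Data.Parity._+_ 1ℙ) ea))
... | ()

-- The pairs `x`, `p x` are removed one after another; `m` bounds what is left and makes the
-- recursion structural.
involution-even : ∀ {n} (p : Fin n → Fin n) m (W : VSet n) → count W ≤ m →
  (∀ v → v ∈ W → p v ∈ W × p v ≢ v × p (p v) ≡ v) → Even (count W)
involution-even p zero    W le h = cong parity (n≤0⇒n≡0 le)
involution-even p (suc m) W le h with any? (mem? W)
... | no ¬e = cong parity (count-empty W (λ v w → ¬e (v , w)))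
... | yes (x , x∈W) = subst Even (≡-sym eq) (involution-even p m W″ le″ h″)
  where
  W′ W″ : VSet _
  W′ = W ∖ ⁅ x ⁆
  W″ = W′ ∖ ⁅ p x ⁆
  eq : count W ≡ suc (suc (count W″))
  eq = trans (count-remove W x x∈W)
    (cong suc (count-remove W′ (p x) (proj₁ (h x x∈W) , proj₁ (proj₂ (h x x∈W)))))
  le″ : count W″ ≤ m
  le″ = ≤-trans (n≤1+n _) (≤-pred (≤-trans (≤-reflexive (≡-sym eq)) le))
  h″ : ∀ v → v ∈ W″ → p v ∈ W″ × p v ≢ v × p (p v) ≡ v
  h″ v ((v∈W , v≢x) , v≢px) with h v v∈W
  ... | pv∈W , pv≢v , ppv = ((pv∈W , λ e → v≢px (trans (≡-sym ppv) (cong p e)))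
    , λ e → v≢x (trans (≡-sym ppv) (trans (cong p e) (proj₂ (proj₂ (h x x∈W)))))) , pv≢v , ppv

-- Adjacency, degrees and matchings

Adj? : ∀ {n} (G : Graph n) u v → Dec (Adj G u v)
Adj? G u v = adj G u v ≟ᵇ true

Adj-sym : ∀ {n} (G : Graph n) {u v} → Adj G u v → Adj G v u
Adj-sym G {u} {v} e = trans (Graph.sym G v u) e

Adj-irrefl : ∀ {n} (G : Graph n) {u v} → Adj G u v → u ≢ v
Adj-irrefl G {u} e refl with trans (≡-sym e) (irrefl G u)
... | ()

neighbours : ∀ {n} → Graph n → Fin n → VSet n
neighbours G v = record { Mem = Adj G v ; mem? = Adj? G v }

degree≡count : ∀ {n} (G : Graph n) v → degree G v ≡ count (neighbours G v)
degree≡count G v = trans (∣tabulate∣ (adj G v))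
  (≤-antisym (sumFin-mono (λ w → ≤-reflexive (eq w))) (sumFin-mono (λ w → ≤-reflexive (≡-sym (eq w)))))
  where
  eq : ∀ w → (if adj G v w then 1 else 0) ≡ ind (Adj? G v w)
  eq w with adj G v w
  ... | true  = refl
  ... | false = refl

Matches : ∀ {n} → Graph n → VSet n → (Fin n → Fin n) → Set
Matches H W p = ∀ v → v ∈ W → p v ∈ W × Adj H v (p v) × p (p v) ≡ v

PerfectMatching : ∀ {n} → Graph n → VSet n → Set
PerfectMatching {n} H W = Σ (Fin n → Fin n) (Matches H W)

-- Walks

data Walk {n : ℕ} (H : Graph n) (W : VSet n) : ℕ → Fin n → Fin n → Set where
  stop : ∀ {a} → a ∈ W → Walk H W 0 a a
  step : ∀ {m a b c} → a ∈ W → Adj H a b → Walk H W m b c → Walk H W (suc m) a c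

walk-start : ∀ {n} {H : Graph n} {W : VSet n} {m a b} → Walk H W m a b → a ∈ W
walk-start (stop a)     = a
walk-start (step a _ _) = a

walk-snoc : ∀ {n} {H : Graph n} {W : VSet n} {m a b c} → Walk H W m a b → Adj H b c → c ∈ W → Walk H W (suc m) a c
walk-snoc (stop b)     e c = step b e (stop c)
walk-snoc (step a f r) e c = step a f (walk-snoc r e c)

walk-invariant : ∀ {n} {H : Graph n} {W : VSet n} (D : Fin n → Set) →
  (∀ w t → w ∈ W → t ∈ W → Adj H w t → D w → D t) → ∀ {m a b} → Walk H W m a b → D a → D b
walk-invariant D inv (stop _)             d = d
walk-invariant D inv (step {a = a} {b} w e r) d = walk-invariant D inv r (inv a b w (walk-start r) e d)

walk-restrict : ∀ {n} {H : Graph n} {W : VSet n} (P : VSet n) →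
  (∀ w t → w ∈ P → t ∈ W → Adj H w t → t ∈ P) → ∀ {m a b} → Walk H W m a b → a ∈ P → Walk H P m a b
walk-restrict P cl (stop _)             p = stop p
walk-restrict P cl (step {a = a} {b} w e r) p = step p e (walk-restrict P cl r (cl a b p (walk-start r) e))

record Component {n : ℕ} (H : Graph n) (W : VSet n) (a : Fin n) : Set₁ where
  field
    C      : VSet n
    root   : a ∈ C
    C⊆W    : ∀ v → v ∈ C → v ∈ W
    closed : ∀ w t → w ∈ C → t ∈ W → Adj H w t → t ∈ C
    reach  : ∀ v → v ∈ C → ∃ λ m → Walk H W m a v

-- Starting from `a`, adjacent vertices of `W` are added while there are any; `d` bounds the
-- vertices still outside and drops each time.
component : ∀ {n} (H : Graph n) (W : VSet n) a → a ∈ W → Component H W a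
component {n} H W a a∈W = grow (count (∁ ⁅ a ⁆)) ⁅ a ⁆ ≤-refl refl (λ { v refl → a∈W }) (λ { v refl → 0 , stop a∈W })
  where
  grow : ∀ d (P : VSet n) → count (∁ P) ≤ d → a ∈ P → (∀ v → v ∈ P → v ∈ W) →
    (∀ v → v ∈ P → ∃ λ m → Walk H W m a v) → Component H W a
  grow d P le a∈P P⊆W r
    with any? (λ w → any? (λ t → mem? P w ×-dec mem? (W ∖ P) t ×-dec Adj? H w t))
  ... | no ¬e = record { C = P ; root = a∈P ; C⊆W = P⊆W ; closed = cl ; reach = r }
    where
    cl : ∀ w t → w ∈ P → t ∈ W → Adj H w t → t ∈ P
    cl w t w∈P t∈W e with mem? P t
    ... | yes p = p
    ... | no ¬p = ⊥-elim (¬e (w , t , w∈P , (t∈W , ¬p) , e))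
  grow zero P le a∈P P⊆W r | yes (w , t , w∈P , (t∈W , t∉P) , e) = ⊥-elim (n≮0 (≤-trans (count-positive (∁ P) t t∉P) le))
  grow (suc d) P le a∈P P⊆W r | yes (w , t , w∈P , (t∈W , t∉P) , e) =
    grow d (P ∪ ⁅ t ⁆) le′ (inj₁ a∈P) (λ { v (inj₁ p) → P⊆W v p ; v (inj₂ refl) → t∈W })
      (λ { v (inj₁ p) → r v p ; v (inj₂ refl) → suc (proj₁ (r w w∈P)) , walk-snoc (proj₂ (r w w∈P)) e t∈W })
    where
    le′ : count (∁ (P ∪ ⁅ t ⁆)) ≤ d
    le′ = ≤-pred (≤-trans (s≤s (count-mono (∁ (P ∪ ⁅ t ⁆)) (∁ P ∖ ⁅ t ⁆) (λ v h → (λ p → h (inj₁ p)) , (λ q → h (inj₂ q)))))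
      (≤-trans (≤-reflexive (≡-sym (count-remove (∁ P) t t∉P))) le))

-- Augmenting a matching along a walk

-- Relative to `W`, because deleting an edge may create claws and only the set in which a matching
-- is augmented has to be free of them.
ClawFreeOn : ∀ {n} → Graph n → VSet n → Set
ClawFreeOn H W = ∀ y a b c → y ∈ W → a ∈ W → b ∈ W → c ∈ W → Adj H y a → Adj H y b → Adj H y c →
  a ≢ b → a ≢ c → b ≢ c → Adj H a b ⊎ Adj H a c ⊎ Adj H b c

record NearPerfect {n : ℕ} (H : Graph n) (W : VSet n) (a b : Fin n) (p : Fin n → Fin n) : Set where
  field
    a∈W : a ∈ W
    b∈W : b ∈ W
    a≢b : a ≢ b
    partner : ∀ w → w ∈ W → w ≢ a → w ≢ b → p w ∈ W × p w ≢ a × p w ≢ b × Adj H w (p w) × p (p w) ≡ w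

-- If `x` was matched, the value at its former partner goes stale: that vertex becomes exposed, and
-- `NearPerfect` ignores the values at exposed vertices.
rematch : ∀ {n} → Fin n → Fin n → (Fin n → Fin n) → Fin n → Fin n
rematch a x p w with w ≟ a | w ≟ x
... | yes _ | _     = x
... | no _  | yes _ = a
... | no _  | no _  = p w

rematch-left : ∀ {n} (a x : Fin n) p → rematch a x p a ≡ x
rematch-left a x p with a ≟ a | a ≟ x
... | yes _ | _ = refl
... | no ¬e | _ = ⊥-elim (¬e refl)

rematch-right : ∀ {n} (a x : Fin n) p → x ≢ a → rematch a x p x ≡ a
rematch-right a x p x≢a with x ≟ a | x ≟ x
... | yes e | _     = ⊥-elim (x≢a e)
... | no _  | yes _ = refl
... | no _  | no ¬e = ⊥-elim (¬e refl)

rematch-other : ∀ {n} (a x : Fin n) p w → w ≢ a → w ≢ x → rematch a x p w ≡ p w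
rematch-other a x p w w≢a w≢x with w ≟ a | w ≟ x
... | yes e | _     = ⊥-elim (w≢a e)
... | no _  | yes e = ⊥-elim (w≢x e)
... | no _  | no _  = refl

-- Flipping the alternating path `a`, `x`, `p x` moves the exposed end from `a` to `p x`.
switch : ∀ {n} (H : Graph n) (W : VSet n) {a b p} x → NearPerfect H W a b p → x ∈ W → x ≢ b →
  Adj H a x → NearPerfect H W (p x) b (rematch a x p)
switch H W {a} {b} {p} x np x∈W x≢b ax = record
  { a∈W = proj₁ px ; b∈W = b∈W ; a≢b = proj₁ (proj₂ (proj₂ px)) ; partner = partner′ }
  where
  open NearPerfect np
  x≢a : x ≢ a
  x≢a e = Adj-irrefl H ax (≡-sym e)
  px = partner x x∈W x≢a x≢b
  x≢px = Adj-irrefl H (proj₁ (proj₂ (proj₂ (proj₂ px))))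
  ppx = proj₂ (proj₂ (proj₂ (proj₂ px)))
  r = rematch a x p
  partner′ : ∀ w → w ∈ W → w ≢ p x → w ≢ b → r w ∈ W × r w ≢ p x × r w ≢ b × Adj H w (r w) × r (r w) ≡ w
  partner′ w w∈W w≢px w≢b = by (w ≟ a) (w ≟ x)
    where
    by : Dec (w ≡ a) → Dec (w ≡ x) → r w ∈ W × r w ≢ p x × r w ≢ b × Adj H w (r w) × r (r w) ≡ w
    by (yes refl) _ rewrite rematch-left a x p = x∈W , x≢px , x≢b , ax , rematch-right a x p x≢a
    by (no _) (yes refl) rewrite rematch-right a x p x≢a =
      a∈W , (λ e → proj₁ (proj₂ px) (≡-sym e)) , a≢b , Adj-sym H ax , rematch-left a x p
    by (no w≢a) (no w≢x) with partner w w∈W w≢a w≢b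
    ... | pw∈W , pw≢a , pw≢b , e , ppw rewrite rematch-other a x p w w≢a w≢x =
      pw∈W , (λ q → w≢x (trans (≡-sym ppw) (trans (cong p q) ppx))) , pw≢b , e ,
      trans (rematch-other a x p (p w) pw≢a (λ q → w≢px (trans (≡-sym ppw) (cong p q)))) ppw

join-ends : ∀ {n} (H : Graph n) (W : VSet n) {a b p} → NearPerfect H W a b p → Adj H a b → PerfectMatching H W
join-ends H W {a} {b} {p} np ab = r , matched
  where
  open NearPerfect np
  r = rematch a b p
  b≢a : b ≢ a
  b≢a e = a≢b (≡-sym e)
  matched : ∀ w → w ∈ W → r w ∈ W × Adj H w (r w) × r (r w) ≡ w
  matched w w∈W = by (w ≟ a) (w ≟ b)
    where
    by : Dec (w ≡ a) → Dec (w ≡ b) → r w ∈ W × Adj H w (r w) × r (r w) ≡ w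
    by (yes refl) _ rewrite rematch-left a b p = b∈W , ab , rematch-right a b p b≢a
    by (no _) (yes refl) rewrite rematch-right a b p b≢a = a∈W , Adj-sym H ab , rematch-left a b p
    by (no w≢a) (no w≢b) with partner w w∈W w≢a w≢b
    ... | pw∈W , pw≢a , pw≢b , e , ppw rewrite rematch-other a b p w w≢a w≢b =
      pw∈W , e , trans (rematch-other a b p (p w) pw≢a pw≢b) ppw

-- The claw at the second vertex x of the walk, with leaves a, the third vertex y and the partner of x,
-- lets the exposed vertex move one step towards b.
augment-step : ∀ {n} (H : Graph n) (W : VSet n) → ClawFreeOn H W → ∀ m {b} →
  (∀ {a p} → NearPerfect H W a b p → Walk H W m a b → PerfectMatching H W) →
  (∀ {a p} → NearPerfect H W a b p → Walk H W (suc m) a b → PerfectMatching H W) →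
  ∀ {a p} → NearPerfect H W a b p → Walk H W (suc (suc m)) a b → PerfectMatching H W
augment-step H W cf m {b} rec rec⁺ {a} {p} np (step a∈W e (step {a = x} {b = y} x∈W f r))
  with x ≟ b
... | yes refl = join-ends H W np e
... | no x≢b with y ≟ a
...   | yes refl = rec np r
...   | no y≢a with p x ≟ y
...     | yes refl = rec (switch H W x np x∈W x≢b e) r
...     | no px≢y with NearPerfect.partner np x x∈W (λ q → Adj-irrefl H e (≡-sym q)) x≢b
...       | q∈W , q≢a , q≢b , xq , qx
  with cf x a y (p x) x∈W a∈W (walk-start r) q∈W (Adj-sym H e) f xq
         (λ q → y≢a (≡-sym q)) (λ q → q≢a (≡-sym q)) (λ q → px≢y (≡-sym q))
-- Each adjacency shortens the walk by one: skip `x`; expose the partner of `x` and go on to `y`; or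
-- match `a` with that partner, which exposes `x`.
...         | inj₁ ay = rec⁺ np (step a∈W ay r)
...         | inj₂ (inj₂ yq) = rec⁺ (switch H W x np x∈W x≢b e) (step q∈W (Adj-sym H yq) r)
...         | inj₂ (inj₁ aq) = rec⁺
  (subst (λ t → NearPerfect H W t b (rematch a (p x) p)) qx (switch H W (p x) np q∈W q≢b aq)) (step x∈W f r)

augment : ∀ {n} (H : Graph n) (W : VSet n) → ClawFreeOn H W → ∀ m {a b p} → NearPerfect H W a b p →
  Walk H W m a b → PerfectMatching H W
augment H W cf zero          np (stop _) = ⊥-elim (NearPerfect.a≢b np refl)
augment H W cf (suc zero)    np (step _ e (stop _)) = join-ends H W np e
augment H W cf (suc (suc m)) np w = augment-step H W cf m (augment H W cf m) (augment H W cf (suc m)) np w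

-- Deleting an edge

-- A relation instead of `deleteEdge` itself, because it is symmetric in `u` and `z`: an argument
-- for one end serves the other with the same `H`.
record Deleted {n : ℕ} (G : Graph n) (u z : Fin n) (H : Graph n) : Set where
  field
    below : ∀ {w t} → Adj H w t → Adj G w t
    above : ∀ {w t} → Adj G w t → Adj H w t ⊎ (w ≡ u × t ≡ z) ⊎ (w ≡ z × t ≡ u)

Deleted-swap : ∀ {n} {G : Graph n} {u z H} → Deleted G u z H → Deleted G z u H
Deleted-swap d = record { below = below ; above = λ e → [ inj₁ , (λ s → inj₂ (swap s)) ]′ (above e) }
  where open Deleted d

isEnd-cases : ∀ {n} (a b w : Fin n) → isEnd a b w ≡ true → w ≡ a ⊎ w ≡ b
isEnd-cases a b w e with w ≟ a | w ≟ b
... | yes p | _     = inj₁ p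
... | no _  | yes q = inj₂ q

deleteEdge-Deleted : ∀ {n} (G : Graph n) u z (e : Adj G u z) → Deleted G u z (deleteEdge G u z e)
deleteEdge-Deleted {n} G u z e = record { below = λ {w} {t} → below w t ; above = λ {w} {t} → above w t }
  where
  below : ∀ w t → Adj (deleteEdge G u z e) w t → Adj G w t
  below w t h with isEnd u z w ∧ isEnd u z t
  ... | false = h
  above : ∀ w t → Adj G w t → Adj (deleteEdge G u z e) w t ⊎ (w ≡ u × t ≡ z) ⊎ (w ≡ z × t ≡ u)
  above w t h with isEnd u z w in ew | isEnd u z t in et
  ... | false | _     = inj₁ h
  ... | true  | false = inj₁ h
  ... | true  | true with isEnd-cases u z w ew | isEnd-cases u z t et
  ...   | inj₁ p    | inj₂ q    = inj₂ (inj₁ (p , q))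
  ...   | inj₂ p    | inj₁ q    = inj₂ (inj₂ (p , q))
  ...   | inj₁ refl | inj₁ refl = ⊥-elim (Adj-irrefl G h refl)
  ...   | inj₂ refl | inj₂ refl = ⊥-elim (Adj-irrefl G h refl)

clawFree-cases : ∀ {n} (G : Graph n) → ClawFree G → ClawFreeOn G full
clawFree-cases G cf y a b c _ _ _ _ ya yb yc a≢b a≢c b≢c with Adj? G a b | Adj? G a c | Adj? G b c
... | yes p | _     | _     = inj₁ p
... | no _  | yes p | _     = inj₂ (inj₁ p)
... | no _  | no _  | yes p = inj₂ (inj₂ p)
... | no p  | no q  | no r  = ⊥-elim (cf y a b c ya yb yc a≢b a≢c b≢c (p , q , r))

-- A claw of `H` that is not one of `G` has `u` and `z` among its leaves, so its centre is a common
-- neighbour of both.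
clawFree-Deleted : ∀ {n} (G : Graph n) → ClawFree G → ∀ {u z H} → Deleted G u z H → (W : VSet n) →
  (∀ y → y ∈ W → u ∈ W → z ∈ W → Adj G y u → Adj G y z → ⊥) → ClawFreeOn H W
clawFree-Deleted G cf {u} {z} {H} d W no-common y a b c y∈ a∈ b∈ c∈ ya yb yc a≢b a≢c b≢c =
  lift-cases (clawFree-cases G cf y a b c tt tt tt tt (below ya) (below yb) (below yc) a≢b a≢c b≢c)
  where
  open Deleted d
  lift : ∀ {s t} → s ∈ W → t ∈ W → Adj H y s → Adj H y t → Adj G s t → Adj H s t
  lift s∈ t∈ ys yt st with above st
  ... | inj₁ h = h
  ... | inj₂ (inj₁ (refl , refl)) = ⊥-elim (no-common y y∈ s∈ t∈ (below ys) (below yt))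
  ... | inj₂ (inj₂ (refl , refl)) = ⊥-elim (no-common y y∈ t∈ s∈ (below yt) (below ys))
  lift-cases : Adj G a b ⊎ Adj G a c ⊎ Adj G b c → Adj H a b ⊎ Adj H a c ⊎ Adj H b c
  lift-cases (inj₁ ab)        = inj₁ (lift a∈ b∈ ya yb ab)
  lift-cases (inj₂ (inj₁ ac)) = inj₂ (inj₁ (lift a∈ c∈ ya yc ac))
  lift-cases (inj₂ (inj₂ bc)) = inj₂ (inj₂ (lift b∈ c∈ yb yc bc))

-- Factor-criticality and parity

matched-even : ∀ {n} (H : Graph n) (W : VSet n) p → Matches H W p → Even (count W)
matched-even H W p h = involution-even p (count W) W ≤-refl
  (λ v v∈W → proj₁ (h v v∈W) , (λ e → Adj-irrefl H (proj₁ (proj₂ (h v v∈W))) (≡-sym e)) , proj₂ (proj₂ (h v v∈W)))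

-- Used with "a matching or a pocket" for every vertex: one matching ends the search, otherwise all
-- pockets are at hand together. Pockets live one universe above matchings, hence the two levels.
choose : ∀ {a b} {A : Set a} {n} {B : Fin n → Set b} → (∀ i → A ⊎ B i) → A ⊎ (∀ i → B i)
choose {n = zero}  f = inj₂ (λ ())
choose {n = suc n} f with f zero | choose (f ∘ suc)
... | inj₁ a | _      = inj₁ a
... | inj₂ _ | inj₁ a = inj₁ a
... | inj₂ b | inj₂ g = inj₂ (λ { zero → b ; (suc i) → g i })

module _ {n k : ℕ} (G : Graph n) (fc : FactorCritical k G) where

  fc-matching : (X : VSet n) → count X ≡ k → PerfectMatching G (∁ X)
  fc-matching X eq with proj₂ (proj₂ fc) (toSubset X) (trans (∣tabulate∣ (λ v → does (mem? X v))) eq)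
  ... | p , h = p , λ v v∉X → (λ pv∈X → proj₁ (h v (λ q → v∉X (∈-toSubset⁻ X v q))) (∈-toSubset⁺ X (p v) pv∈X))
                              , proj₂ (h v (λ q → v∉X (∈-toSubset⁻ X v q)))

  -- `Y` is a union of components of G - A, so the perfect matching of G - A restricts to it.
  fc-even : (A Y : VSet n) → count A ≡ k → (∀ v → v ∈ Y → v ∉ A) →
    (∀ w t → w ∈ Y → Adj G w t → t ∈ Y ⊎ t ∈ A) → Even (count Y)
  fc-even A Y eq disj exits with fc-matching A eq
  ... | p , h = matched-even G Y p matched
    where
    matched : Matches G Y p
    matched v v∈Y with h v (disj v v∈Y)
    ... | pv∉A , e , ppv = [ id , (λ a → ⊥-elim (pv∉A a)) ]′ (exits v (p v) v∈Y e) , e , ppv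

  -- Removing z₀ makes Y a union of components, removing y₀ makes Y minus y₀ one, but the two differ in parity.
  separation : (Y X : VSet n) (y₀ z₀ : Fin n) → count X < k → y₀ ∈ Y → z₀ ∉ Y → z₀ ∉ X →
    (∀ v → v ∈ Y → v ∉ X) → (∀ w t → w ∈ Y → Adj G w t → t ∈ Y ⊎ t ∈ X ⊎ (w ≡ y₀ × t ≡ z₀)) → ⊥
  separation Y X y₀ z₀ lt y₀∈Y z₀∉Y z₀∉X disj exits = by k refl lt
    where
    y₀≢z₀ : y₀ ≢ z₀
    y₀≢z₀ refl = z₀∉Y y₀∈Y
    U : VSet n
    U = full ∖ ⁅ y₀ ⁆ ∖ ⁅ z₀ ⁆
    size-U : n ≡ suc (suc (count U))
    size-U = trans (≡-sym (count-full n)) (trans (count-remove full y₀ tt)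
      (cong suc (count-remove (full ∖ ⁅ y₀ ⁆) z₀ (tt , λ e → y₀≢z₀ (≡-sym e)))))
    X⊆U : ∀ v → v ∈ X → v ∈ U
    X⊆U v v∈X = (tt , λ { refl → disj v y₀∈Y v∈X }) , λ { refl → z₀∉X v∈X }
    by : ∀ k′ → k ≡ k′ → count X < k′ → ⊥
    -- As `k < n`, at least k - 1 vertices remain besides `y₀` and `z₀`, so `X` can be padded to
    -- exactly k - 1 of them; adding either of the two then gives size `k`.
    by (suc j) eq (s≤s le) with superset-of-size X U j X⊆U le
      (≤-pred (≤-pred (≤-trans (subst (_< n) eq (proj₁ (proj₂ fc))) (≤-reflexive size-U))))
    ... | X⁺ , X⊆X⁺ , X⁺⊆U , size = even-suc-odd (count (Y⁺ ∖ ⁅ y₀ ⁆)) even-without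
        (subst Even (count-remove Y⁺ y₀ (y₀∈Y , y₀∉X⁺)) even-with)
      where
      Y⁺ : VSet n
      Y⁺ = Y ∖ X⁺
      y₀∉X⁺ : y₀ ∉ X⁺
      y₀∉X⁺ h = proj₂ (proj₁ (X⁺⊆U y₀ h)) refl
      z₀∉X⁺ : z₀ ∉ X⁺
      z₀∉X⁺ h = proj₂ (X⁺⊆U z₀ h) refl
      leave : ∀ w t → w ∈ Y → Adj G w t → t ∈ Y⁺ ⊎ t ∈ X⁺ ⊎ (w ≡ y₀ × t ≡ z₀)
      leave w t w∈Y e with exits w t w∈Y e | mem? X⁺ t
      ... | _ | yes t∈X⁺ = inj₂ (inj₁ t∈X⁺)
      ... | inj₁ t∈Y | no t∉X⁺ = inj₁ (t∈Y , t∉X⁺)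
      ... | inj₂ (inj₁ t∈X) | no _ = inj₂ (inj₁ (X⊆X⁺ t t∈X))
      ... | inj₂ (inj₂ q) | no _ = inj₂ (inj₂ q)
      even-with : Even (count Y⁺)
      even-with = fc-even (X⁺ ∪ ⁅ z₀ ⁆) Y⁺ (trans (count-insert X⁺ z₀ z₀∉X⁺) (trans (cong suc size) (≡-sym eq)))
        (λ { v (v∈Y , v∉X⁺) (inj₁ h) → v∉X⁺ h ; v (v∈Y , v∉X⁺) (inj₂ refl) → z₀∉Y v∈Y }) exits⁺
        where
        exits⁺ : ∀ w t → w ∈ Y⁺ → Adj G w t → t ∈ Y⁺ ⊎ t ∈ X⁺ ∪ ⁅ z₀ ⁆
        exits⁺ w t (w∈Y , _) e with leave w t w∈Y e
        ... | inj₁ h = inj₁ h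
        ... | inj₂ (inj₁ h) = inj₂ (inj₁ h)
        ... | inj₂ (inj₂ (_ , t≡z₀)) = inj₂ (inj₂ t≡z₀)
      even-without : Even (count (Y⁺ ∖ ⁅ y₀ ⁆))
      even-without = fc-even (X⁺ ∪ ⁅ y₀ ⁆) (Y⁺ ∖ ⁅ y₀ ⁆) (trans (count-insert X⁺ y₀ y₀∉X⁺) (trans (cong suc size) (≡-sym eq)))
        (λ { v ((v∈Y , v∉X⁺) , _) (inj₁ h) → v∉X⁺ h ; v (_ , v≢y₀) (inj₂ h) → v≢y₀ h }) exits⁻
        where
        exits⁻ : ∀ w t → w ∈ Y⁺ ∖ ⁅ y₀ ⁆ → Adj G w t → t ∈ Y⁺ ∖ ⁅ y₀ ⁆ ⊎ t ∈ X⁺ ∪ ⁅ y₀ ⁆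
        exits⁻ w t ((w∈Y , _) , w≢y₀) e with leave w t w∈Y e
        ... | inj₂ (inj₁ h) = inj₂ (inj₁ h)
        ... | inj₂ (inj₂ (h , _)) = ⊥-elim (w≢y₀ h)
        ... | inj₁ h with t ≟ y₀
        ...   | yes q = inj₂ (inj₂ q)
        ...   | no q  = inj₁ (h , q)

-- Fragments

-- Once the edge uv is deleted, X separates F from the rest.
record Fragment {n : ℕ} (k : ℕ) (G : Graph n) (u v : Fin n) : Set₁ where
  field
    F X   : VSet n
    size  : count X ≤ k
    u∈F   : u ∈ F
    v∉F   : v ∉ F
    v∉X   : v ∉ X
    disj  : ∀ w → w ∈ F → w ∉ X
    exits : ∀ w t → w ∈ F → Adj G w t → t ∈ F ⊎ t ∈ X ⊎ (w ≡ u × t ≡ v)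

flip-fragment : ∀ {n k} {G : Graph n} {u v} → Fragment k G u v → Fragment k G v u
flip-fragment {G = G} {u} {v} f = record
  { F = ∁ (F ∪ X) ; X = X ; size = size ; u∈F = [ v∉F , v∉X ]′ ; v∉F = λ h → h (inj₁ u∈F)
  ; v∉X = disj u u∈F ; disj = λ w h x → h (inj₂ x) ; exits = exits′ }
  where
  open Fragment f
  exits′ : ∀ w t → w ∈ ∁ (F ∪ X) → Adj G w t → t ∈ ∁ (F ∪ X) ⊎ t ∈ X ⊎ (w ≡ v × t ≡ u)
  exits′ w t h e with mem? X t | mem? F t
  ... | yes t∈X | _       = inj₂ (inj₁ t∈X)
  ... | no t∉X  | no t∉F  = inj₁ [ t∉F , t∉X ]′
  ... | no _    | yes t∈F with exits t w t∈F (Adj-sym G e)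
  ...   | inj₁ w∈F = ⊥-elim (h (inj₁ w∈F))
  ...   | inj₂ (inj₁ w∈X) = ⊥-elim (h (inj₂ w∈X))
  ...   | inj₂ (inj₂ (p , q)) = inj₂ (inj₂ (q , p))

-- P and Q are the two parts of G − T that only the edge uz joins; far gives each t ∈ T a neighbour in a third part.
record Barrier {n : ℕ} (k : ℕ) (G : Graph n) (u z : Fin n) : Set₁ where
  field
    T P Q  : VSet n
    size   : count T ≤ suc k
    u∈P    : u ∈ P
    z∈Q    : z ∈ Q
    P∩Q    : ∀ w → w ∈ P → w ∉ Q
    P∩T    : ∀ w → w ∈ P → w ∉ T
    Q∩T    : ∀ w → w ∈ Q → w ∉ T
    exitsP : ∀ w t → w ∈ P → Adj G w t → t ∈ P ⊎ t ∈ T ⊎ (w ≡ u × t ≡ z)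
    exitsQ : ∀ w t → w ∈ Q → Adj G w t → t ∈ Q ⊎ t ∈ T ⊎ (w ≡ z × t ≡ u)
    far    : ∀ t → t ∈ T → ∃ λ c → Adj G t c × (∀ w → w ∈ P ∪ Q → c ≢ w × ¬ Adj G w c)
    even   : Even (count (P ∪ Q))

-- Barriers

-- If the partner c of y reached u without X, y and z, then matching y with z and augmenting from c to u
-- would replace the edge uz.
separate : ∀ {n} (G : Graph n) → ClawFree G → ∀ {u z H} → Deleted G u z H → (X : VSet n) (M : Fin n → Fin n) →
  Matches G (∁ X) M → u ∉ X → z ∉ X → M u ≡ z → M z ≡ u →
  ∀ y → Adj G u y → Adj G z y → y ∉ X →
  PerfectMatching H (∁ X) ⊎
  Σ (VSet n) λ C → M y ∈ C × u ∉ C × (∀ v → v ∈ C → v ∉ X × v ≢ y × v ≢ z) ×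
    (∀ w t → w ∈ C → Adj G w t → t ∈ C ⊎ t ∈ X ⊎ t ≡ y ⊎ t ≡ z)
separate {n} G cf {u} {z} {H} del X M M-ok u∉X z∉X Mu Mz y uy zy y∉X = by (mem? C u)
  where
  open Deleted del
  c : Fin n
  c = M y
  yc : Adj G y c
  yc = proj₁ (proj₂ (M-ok y y∉X))
  Mc : M c ≡ y
  Mc = proj₂ (proj₂ (M-ok y y∉X))
  u≢z : u ≢ z
  u≢z = Adj-irrefl G (subst (Adj G u) Mu (proj₁ (proj₂ (M-ok u u∉X))))
  c≢u : c ≢ u
  c≢u e = Adj-irrefl G zy (trans (≡-sym Mu) (trans (cong M (≡-sym e)) Mc))
  c≢z : c ≢ z
  c≢z e = Adj-irrefl G uy (trans (≡-sym Mz) (trans (cong M (≡-sym e)) Mc))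
  W : VSet n
  W = ∁ X ∖ ⁅ y ⁆ ∖ ⁅ z ⁆
  c∈W : c ∈ W
  c∈W = (proj₁ (M-ok y y∉X) , λ e → Adj-irrefl G yc (≡-sym e)) , c≢z
  u∈W : u ∈ W
  u∈W = (u∉X , Adj-irrefl G uy) , u≢z
  open Component (component H W c c∈W)

  -- The partners of `c` and `u` are `y` and `z`, both removed, so `M` leaves exactly these two
  -- exposed in `W`.
  near : NearPerfect H W c u M
  near = record { a∈W = c∈W ; b∈W = u∈W ; a≢b = c≢u ; partner = partner }
    where
    partner : ∀ w → w ∈ W → w ≢ c → w ≢ u → M w ∈ W × M w ≢ c × M w ≢ u × Adj H w (M w) × M (M w) ≡ w
    partner w ((w∉X , w≢y) , w≢z) w≢c w≢u with M-ok w w∉X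
    ... | Mw∉X , e , MMw = ((Mw∉X , λ q → w≢c (trans (≡-sym MMw) (cong M q))) , λ q → w≢u (trans (≡-sym MMw) (trans (cong M q) Mz)))
      , (λ q → w≢y (trans (≡-sym MMw) (trans (cong M q) Mc)))
      , (λ q → w≢z (trans (≡-sym MMw) (trans (cong M q) Mu)))
      , edge (above e) , MMw
      where
      edge : Adj H w (M w) ⊎ (w ≡ u × M w ≡ z) ⊎ (w ≡ z × M w ≡ u) → Adj H w (M w)
      edge (inj₁ h) = h
      edge (inj₂ (inj₁ (q , _))) = ⊥-elim (w≢u q)
      edge (inj₂ (inj₂ (q , _))) = ⊥-elim (w≢z q)

  yz : Adj H y z
  yz with above (Adj-sym G zy)
  ... | inj₁ h = h
  ... | inj₂ (inj₁ (refl , _)) = ⊥-elim (Adj-irrefl G uy refl)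
  ... | inj₂ (inj₂ (refl , _)) = ⊥-elim (Adj-irrefl G zy refl)

  by : Dec (u ∈ C) → PerfectMatching H (∁ X) ⊎
    Σ (VSet n) λ C → M y ∈ C × u ∉ C × (∀ v → v ∈ C → v ∉ X × v ≢ y × v ≢ z) ×
      (∀ w t → w ∈ C → Adj G w t → t ∈ C ⊎ t ∈ X ⊎ t ≡ y ⊎ t ≡ z)
  by (yes u∈C) with reach u u∈C
  ... | m , walk with augment H W (clawFree-Deleted G cf del W (λ _ _ _ z∈W _ _ → proj₂ z∈W refl)) m near walk
  ...   | p , p-ok = inj₁ (join-ends H (∁ X) near′ yz)
    where
    near′ : NearPerfect H (∁ X) y z p
    near′ = record { a∈W = y∉X ; b∈W = z∉X ; a≢b = λ e → Adj-irrefl G zy (≡-sym e) ; partner = partner }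
      where
      partner : ∀ w → w ∉ X → w ≢ y → w ≢ z → p w ∉ X × p w ≢ y × p w ≢ z × Adj H w (p w) × p (p w) ≡ w
      partner w w∉X w≢y w≢z with p-ok w ((w∉X , w≢y) , w≢z)
      ... | ((pw∉X , pw≢y) , pw≢z) , e , ppw = pw∉X , pw≢y , pw≢z , e , ppw
  by (no u∉C) = inj₂ (C , root , u∉C ,
    (λ v v∈C → proj₁ (proj₁ (C⊆W v v∈C)) , proj₂ (proj₁ (C⊆W v v∈C)) , proj₂ (C⊆W v v∈C)) , exits)
    where
    exits : ∀ w t → w ∈ C → Adj G w t → t ∈ C ⊎ t ∈ X ⊎ t ≡ y ⊎ t ≡ z
    exits w t w∈C e with mem? X t | t ≟ y | t ≟ z | above e
    ... | yes h | _     | _     | _ = inj₂ (inj₁ h)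
    ... | no _  | yes h | _     | _ = inj₂ (inj₂ (inj₁ h))
    ... | no _  | no _  | yes h | _ = inj₂ (inj₂ (inj₂ h))
    ... | no a  | no b  | no d  | inj₁ h = inj₁ (closed w t w∈C ((a , b) , d) h)
    ... | no _  | no _  | no d  | inj₂ (inj₁ (_ , h)) = ⊥-elim (d h)
    ... | no _  | no _  | no _  | inj₂ (inj₂ (refl , _)) = ⊥-elim (proj₂ (C⊆W w w∈C) refl)

module Core {n k : ℕ} (G : Graph n) (cf : ClawFree G) (fc : FactorCritical k G) {u z : Fin n} {H : Graph n}
  (del : Deleted G u z H) (X : VSet n) (|X| : count X ≡ k) (M : Fin n → Fin n) (M-ok : Matches G (∁ X) M)
  (u∉X : u ∉ X) (z∉X : z ∉ X) (Mu : M u ≡ z) (Mz : M z ≡ u) where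
  open Deleted del

  u~z : Adj G u z
  u~z = subst (Adj G u) Mu (proj₁ (proj₂ (M-ok u u∉X)))

  Y : VSet n
  Y = neighbours G u ∩ neighbours G z ∩ ∁ X

  -- A union of components of G − X − y that contains the partner of y but neither u nor z.
  record Pocket (y : Fin n) : Set₁ where
    field
      C     : VSet n
      c∈C   : M y ∈ C
      u∉C   : u ∉ C
      z∉C   : z ∉ C
      y∉C   : y ∉ C
      C∩X   : ∀ v → v ∈ C → v ∉ X
      exits : ∀ w t → w ∈ C → Adj G w t → t ∈ C ⊎ t ∈ X ⊎ t ≡ y

    exits′ : ∀ w t → w ∈ C → Adj G w t → t ∉ C → t ∉ X → t ≢ y → ⊥
    exits′ w t w∈C e a b c with exits w t w∈C e
    ... | inj₁ h        = a h
    ... | inj₂ (inj₁ h) = b h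
    ... | inj₂ (inj₂ h) = c h

    -- Such a vertex is adjacent to `u`, which is not in `C`, not in `X` and not `y`.
    Y∩C : ∀ y′ → y′ ∈ Y → y ∈ Y → y′ ∉ C
    Y∩C y′ (uy′ , _) (uy , _) y′∈C = exits′ y′ u y′∈C (Adj-sym G uy′) u∉C u∉X (Adj-irrefl G uy)

  -- Applied from both ends, `separate` gives `C₁`, which may be left through `z`, and `C₂`, which
  -- may be left through `u`. As `C₁` avoids `u` and `C₂` avoids `z`, their intersection is left
  -- only through `X` and `y`.
  pocket : ∀ y → y ∈ Y → PerfectMatching H (∁ X) ⊎ Pocket y
  pocket y (uy , zy , y∉X)
    with separate G cf del X M M-ok u∉X z∉X Mu Mz y uy zy y∉X
       | separate G cf (Deleted-swap del) X M M-ok z∉X u∉X Mz Mu y zy uy y∉X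
  ... | inj₁ p | _      = inj₁ p
  ... | inj₂ _ | inj₁ p = inj₁ p
  ... | inj₂ (C₁ , c∈C₁ , u∉C₁ , in₁ , out₁) | inj₂ (C₂ , c∈C₂ , z∉C₂ , in₂ , out₂) = inj₂ (record
    { C = C₁ ∩ C₂ ; c∈C = c∈C₁ , c∈C₂ ; u∉C = λ h → u∉C₁ (proj₁ h) ; z∉C = λ h → z∉C₂ (proj₂ h)
    ; y∉C = λ h → proj₁ (proj₂ (in₁ y (proj₁ h))) refl ; C∩X = λ v h → proj₁ (in₁ v (proj₁ h)) ; exits = exits })
    where
    exits : ∀ w t → w ∈ C₁ ∩ C₂ → Adj G w t → t ∈ C₁ ∩ C₂ ⊎ t ∈ X ⊎ t ≡ y
    exits w t (h₁ , h₂) e with out₁ w t h₁ e | out₂ w t h₂ e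
    ... | inj₂ (inj₁ a) | _ = inj₂ (inj₁ a)
    ... | inj₂ (inj₂ (inj₁ a)) | _ = inj₂ (inj₂ a)
    ... | inj₁ _ | inj₂ (inj₁ a) = inj₂ (inj₁ a)
    ... | inj₁ _ | inj₂ (inj₂ (inj₁ a)) = inj₂ (inj₂ a)
    ... | inj₁ a | inj₁ b = inj₁ (a , b)
    ... | inj₁ a | inj₂ (inj₂ (inj₂ refl)) = ⊥-elim (u∉C₁ a)
    ... | inj₂ (inj₂ (inj₂ _)) | inj₂ (inj₁ a) = inj₂ (inj₁ a)
    ... | inj₂ (inj₂ (inj₂ _)) | inj₂ (inj₂ (inj₁ a)) = inj₂ (inj₂ a)
    ... | inj₂ (inj₂ (inj₂ refl)) | inj₁ a = ⊥-elim (z∉C₂ a)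
    ... | inj₂ (inj₂ (inj₂ refl)) | inj₂ (inj₂ (inj₂ q)) = ⊥-elim (Adj-irrefl G u~z (≡-sym q))

  -- C is odd, since M matches all of it but the partner of y.
  pocket-sees : ∀ {y} → y ∈ Y → (pk : Pocket y) → ∀ x → x ∈ X → ∃ λ t → t ∈ Pocket.C pk × Adj G x t
  pocket-sees {y} (uy , zy , y∉X) pk x x∈X with any? (λ t → mem? (Pocket.C pk) t ×-dec Adj? G x t)
  ... | yes found = found
  ... | no ¬found = ⊥-elim (even-suc-odd (count (C ∖ ⁅ M y ⁆)) even-rest (subst Even (count-remove C (M y) c∈C) even-C))
    where
    open Pocket pk
    -- Trading `x` for `y` keeps the size `k`; if `x` has no neighbour in `C`, all exits of `C` lie
    -- in `A`, which makes `C` even.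
    A : VSet n
    A = X ∖ ⁅ x ⁆ ∪ ⁅ y ⁆
    |A| : count A ≡ k
    |A| = trans (count-insert (X ∖ ⁅ x ⁆) y (λ h → y∉X (proj₁ h))) (trans (≡-sym (count-remove X x x∈X)) |X|)
    even-C : Even (count C)
    even-C = fc-even G fc A C |A| (λ { v v∈C (inj₁ (h , _)) → C∩X v v∈C h ; v v∈C (inj₂ refl) → y∉C v∈C }) exitsA
      where
      exitsA : ∀ w t → w ∈ C → Adj G w t → t ∈ C ⊎ t ∈ A
      exitsA w t w∈C e with exits w t w∈C e
      ... | inj₁ h = inj₁ h
      ... | inj₂ (inj₁ h) = inj₂ (inj₁ (h , λ { refl → ¬found (w , w∈C , Adj-sym G e) }))
      ... | inj₂ (inj₂ h) = inj₂ (inj₂ h)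
    even-rest : Even (count (C ∖ ⁅ M y ⁆))
    even-rest = matched-even G (C ∖ ⁅ M y ⁆) M matched
      where
      matched : Matches G (C ∖ ⁅ M y ⁆) M
      matched w (w∈C , w≢c) with M-ok w (C∩X w w∈C)
      ... | Mw∉X , e , MMw with exits w (M w) w∈C e
      ...   | inj₁ h = (h , λ q → y∉C (subst (_∈ C) (trans (≡-sym MMw) (trans (cong M q) (proj₂ (proj₂ (M-ok y y∉X))))) w∈C)) , e , MMw
      ...   | inj₂ (inj₁ h) = ⊥-elim (Mw∉X h)
      ...   | inj₂ (inj₂ h) = ⊥-elim (w≢c (trans (≡-sym MMw) (cong M h)))

  -- Serves to make pockets disjoint. No edge joins `C ∖ C′` to `C′`, because `C′` is left only
  -- through `X` and `y′`, which `C` avoids. The partner of `y` is kept: in `C′` it would give an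
  -- exit to `y`.
  refine : ∀ {y y′} → y ∈ Y → y′ ∈ Y → y ≢ y′ → Pocket y → Pocket y′ → Pocket y
  refine {y} {y′} y∈Y@(uy , zy , y∉X) y′∈Y y≢y′ pk pk′ = record
    { C = C ∖ C′ ; c∈C = c∈C , c∉C′ ; u∉C = λ h → u∉C (proj₁ h) ; z∉C = λ h → z∉C (proj₁ h)
    ; y∉C = λ h → y∉C (proj₁ h) ; C∩X = λ v h → C∩X v (proj₁ h) ; exits = exits″ }
    where
    open Pocket pk
    module N = Pocket pk′
    C′ : VSet n
    C′ = N.C
    c∉C′ : M y ∉ C′
    c∉C′ h = N.exits′ (M y) y h (Adj-sym G (proj₁ (proj₂ (M-ok y y∉X)))) (N.Y∩C y y∈Y y′∈Y) y∉X y≢y′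
    exits″ : ∀ w t → w ∈ C ∖ C′ → Adj G w t → t ∈ C ∖ C′ ⊎ t ∈ X ⊎ t ≡ y
    exits″ w t (w∈C , w∉C′) e with exits w t w∈C e
    ... | inj₂ h = inj₂ h
    ... | inj₁ h = inj₁ (h , λ t∈C′ → N.exits′ t w t∈C′ (Adj-sym G e) w∉C′ (C∩X w w∈C)
                               (λ { refl → Y∩C y′ y′∈Y y∈Y w∈C }))

  -- After refinement `x` has a neighbour in each of two disjoint pockets, and `w` would be the
  -- third leaf of a claw at `x`.
  two-pockets : ∀ {y y′} → y ∈ Y → y′ ∈ Y → y ≢ y′ → (pk : Pocket y) (pk′ : Pocket y′) → ∀ x w → x ∈ X → Adj G x w →
    w ∉ Pocket.C pk → w ∉ Pocket.C pk′ → w ∉ X → w ∉ Y → ⊥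
  two-pockets {y} {y′} y∈Y y′∈Y y≢y′ pk pk′ x w x∈X xw w∉C w∉C′ w∉X w∉Y
    with pocket-sees y∈Y (refine y∈Y y′∈Y y≢y′ pk pk′) x x∈X | pocket-sees y′∈Y pk′ x x∈X
  ... | t , (t∈C , t∉C′) , xt | t′ , t′∈C′ , xt′ = cf x t t′ w xt xt′ xw
    (λ { refl → t∉C′ t′∈C′ }) (λ { refl → w∉C t∈C }) (λ { refl → w∉C′ t′∈C′ })
    ( (λ e → N.exits′ t′ t t′∈C′ (Adj-sym G e) t∉C′ (C∩X t t∈C) (λ { refl → Y∩C y′ y′∈Y y∈Y t∈C }))
    , (λ e → exits′ t w t∈C e w∉C w∉X (λ { refl → w∉Y y∈Y }))
    , (λ e → N.exits′ t′ w t′∈C′ e w∉C′ w∉X (λ { refl → w∉Y y′∈Y })) )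
    where
    open Pocket pk
    module N = Pocket pk′

  W : VSet n
  W = ∁ X ∖ Y

  u∈W : u ∈ W
  u∈W = u∉X , λ h → Adj-irrefl G (proj₁ h) refl

  z∈W : z ∈ W
  z∈W = z∉X , λ h → Adj-irrefl G (proj₁ (proj₂ h)) refl

  module KP = Component (component H W u u∈W)
  module KQ = Component (component H W z z∈W)

  P Q : VSet n
  P = KP.C
  Q = KQ.C

  M-edge : ∀ w → w ∉ X → w ≢ u → w ≢ z → Adj H w (M w)
  M-edge w w∉X w≢u w≢z with above (proj₁ (proj₂ (M-ok w w∉X)))
  ... | inj₁ h = h
  ... | inj₂ (inj₁ (q , _)) = ⊥-elim (w≢u q)
  ... | inj₂ (inj₂ (q , _)) = ⊥-elim (w≢z q)

  module Pockets (pockets : ∀ y → y ∈ Y → Pocket y) where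

    pocketC : ∀ y → y ∈ Y → VSet n
    pocketC y h = Pocket.C (pockets y h)

    -- A pocket is left only through `X` and its vertex of `Y`, both outside `W`, so a walk in `W`
    -- that starts outside never enters it.
    avoids : ∀ {a} (K : Component H W a) → (∀ y (h : y ∈ Y) → a ∉ pocketC y h) →
      ∀ w → w ∈ Component.C K → ∀ y (h : y ∈ Y) → w ∉ pocketC y h
    avoids K a∉ w w∈K y h = walk-invariant (_∉ pocketC y h) inv (proj₂ (Component.reach K w w∈K)) (a∉ y h)
      where
      inv : ∀ s t → s ∈ W → t ∈ W → Adj H s t → s ∉ pocketC y h → t ∉ pocketC y h
      inv s t (s∉X , s∉Y) _ e s∉C t∈C = Pocket.exits′ (pockets y h) t s t∈C (Adj-sym G (below e)) s∉C s∉X (λ { refl → s∉Y h })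

    -- If `M w` were in `Y`, then `w`, being its partner, would lie in its pocket, against `avoids`.
    M-stays : ∀ {a} (K : Component H W a) → (∀ y (h : y ∈ Y) → a ∉ pocketC y h) →
      ∀ w → w ∈ Component.C K → w ≢ u → w ≢ z → M w ∈ Component.C K
    M-stays K a∉ w w∈K w≢u w≢z with Component.C⊆W K w w∈K
    ... | w∉X , w∉Y with M-ok w w∉X
    ...   | Mw∉X , e , MMw = Component.closed K w (M w) w∈K (Mw∉X , Mw∉Y) (M-edge w w∉X w≢u w≢z)
      where
      Mw∉Y : M w ∉ Y
      Mw∉Y h = avoids K a∉ w w∈K (M w) h (subst (_∈ pocketC (M w) h) MMw (Pocket.c∈C (pockets (M w) h)))

    u∉ : ∀ y (h : y ∈ Y) → u ∉ pocketC y h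
    u∉ y h = Pocket.u∉C (pockets y h)

    z∉ : ∀ y (h : y ∈ Y) → z ∉ pocketC y h
    z∉ y h = Pocket.z∉C (pockets y h)

    -- Without `uz`, only `u` and `z` are exposed in `P`, and `P` has no common neighbour of the two
    -- to centre a claw, so a walk between them allows augmentation.
    connected : z ∈ P → PerfectMatching H (∁ X)
    connected z∈P with KP.reach z z∈P
    ... | m , walk with augment H P (clawFree-Deleted G cf del P no-common) m near (walk-restrict P KP.closed walk KP.root)
      where
      no-common : ∀ y → y ∈ P → u ∈ P → z ∈ P → Adj G y u → Adj G y z → ⊥
      no-common y y∈P _ _ yu yz = proj₂ (KP.C⊆W y y∈P) (Adj-sym G yu , Adj-sym G yz , proj₁ (KP.C⊆W y y∈P))
      near : NearPerfect H P u z M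
      near = record { a∈W = KP.root ; b∈W = z∈P ; a≢b = Adj-irrefl G u~z ; partner = partner }
        where
        partner : ∀ w → w ∈ P → w ≢ u → w ≢ z → M w ∈ P × M w ≢ u × M w ≢ z × Adj H w (M w) × M (M w) ≡ w
        partner w w∈P w≢u w≢z with M-ok w (proj₁ (KP.C⊆W w w∈P))
        ... | Mw∉X , e , MMw = M-stays (component H W u u∈W) u∉ w w∈P w≢u w≢z
          , (λ q → w≢z (trans (≡-sym MMw) (trans (cong M q) Mu))) , (λ q → w≢u (trans (≡-sym MMw) (trans (cong M q) Mz)))
          , M-edge w (proj₁ (KP.C⊆W w w∈P)) w≢u w≢z , MMw
    ...   | p , p-ok = r , r-ok
      where
      -- `p` preserves `P` and `M` preserves the rest of G - X, so the two can be combined.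
      glue : ∀ w → Dec (w ∈ P) → Fin n
      glue w (yes _) = p w
      glue w (no _)  = M w
      glue-in : ∀ w → w ∈ P → (d : Dec (w ∈ P)) → glue w d ≡ p w
      glue-in w h (yes _) = refl
      glue-in w h (no ¬h) = ⊥-elim (¬h h)
      glue-out : ∀ w → w ∉ P → (d : Dec (w ∈ P)) → glue w d ≡ M w
      glue-out w ¬h (yes h) = ⊥-elim (¬h h)
      glue-out w ¬h (no _)  = refl
      r : Fin n → Fin n
      r w = glue w (mem? P w)
      r-ok : Matches H (∁ X) r
      r-ok w w∉X = by (mem? P w)
        where
        by : Dec (w ∈ P) → r w ∉ X × Adj H w (r w) × r (r w) ≡ w
        by (yes h) rewrite glue-in w h (mem? P w) with p-ok w h
        ... | pw∈P , e , ppw = proj₁ (KP.C⊆W (p w) pw∈P) , e , trans (glue-in (p w) pw∈P (mem? P (p w))) ppw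
        by (no ¬h) rewrite glue-out w ¬h (mem? P w) with M-ok w w∉X
        ... | Mw∉X , e , MMw = Mw∉X , M-edge w w∉X (λ { refl → ¬h KP.root }) (λ { refl → ¬h z∈P })
            , trans (glue-out (M w) Mw∉P (mem? P (M w))) MMw
          where
          Mw∉P : M w ∉ P
          Mw∉P q = ¬h (subst (_∈ P) MMw (M-stays (component H W u u∈W) u∉ (M w) q
            (λ s → ¬h (subst (_∈ P) (trans (≡-sym Mu) (trans (cong M (≡-sym s)) MMw)) z∈P))
            (λ s → ¬h (subst (_∈ P) (trans (≡-sym Mz) (trans (cong M (≡-sym s)) MMw)) KP.root))))

    module Disconnected (z∉P : z ∉ P) where

      Q∩P : ∀ w → w ∈ Q → w ∉ P
      Q∩P w w∈Q = walk-invariant (_∉ P) (λ s t s∈W _ e s∉P t∈P → s∉P (KP.closed t s t∈P s∈W (Adj-sym H e)))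
        (proj₂ (KQ.reach w w∈Q)) z∉P

      leaveP : ∀ w t → w ∈ P → Adj G w t → t ∈ P ⊎ (t ∈ X ⊎ t ∈ Y) ⊎ (w ≡ u × t ≡ z)
      leaveP w t w∈P e with mem? X t | mem? Y t | above e
      ... | yes h | _     | _ = inj₂ (inj₁ (inj₁ h))
      ... | no _  | yes h | _ = inj₂ (inj₁ (inj₂ h))
      ... | no a  | no b  | inj₁ h = inj₁ (KP.closed w t w∈P (a , b) h)
      ... | no _  | no _  | inj₂ (inj₁ h) = inj₂ (inj₂ h)
      ... | no _  | no _  | inj₂ (inj₂ (refl , _)) = ⊥-elim (z∉P w∈P)

      leaveQ : ∀ w t → w ∈ Q → Adj G w t → t ∈ Q ⊎ (t ∈ X ⊎ t ∈ Y) ⊎ (w ≡ z × t ≡ u)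
      leaveQ w t w∈Q e with mem? X t | mem? Y t | above e
      ... | yes h | _     | _ = inj₂ (inj₁ (inj₁ h))
      ... | no _  | yes h | _ = inj₂ (inj₁ (inj₂ h))
      ... | no a  | no b  | inj₁ h = inj₁ (KQ.closed w t w∈Q (a , b) h)
      ... | no _  | no _  | inj₂ (inj₂ h) = inj₂ (inj₂ h)
      ... | no _  | no _  | inj₂ (inj₁ (refl , _)) = ⊥-elim (Q∩P w w∈Q KP.root)

      PQ⊆W : ∀ w → w ∈ P ∪ Q → w ∈ W
      PQ⊆W w (inj₁ h) = KP.C⊆W w h
      PQ⊆W w (inj₂ h) = KQ.C⊆W w h

      PQ-avoids : ∀ w → w ∈ P ∪ Q → ∀ y (h : y ∈ Y) → w ∉ pocketC y h
      PQ-avoids w (inj₁ h) = avoids (component H W u u∈W) u∉ w h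
      PQ-avoids w (inj₂ h) = avoids (component H W z z∈W) z∉ w h

      even-PQ : Even (count (P ∪ Q))
      even-PQ = matched-even G (P ∪ Q) M (λ w h → stay w h (w ≟ u) (w ≟ z) , proj₂ (M-ok w (proj₁ (PQ⊆W w h))))
        where
        stay : ∀ w → w ∈ P ∪ Q → Dec (w ≡ u) → Dec (w ≡ z) → M w ∈ P ∪ Q
        stay w h (yes refl) _ = inj₂ (subst (_∈ Q) (≡-sym Mu) KQ.root)
        stay w h (no _) (yes refl) = inj₁ (subst (_∈ P) (≡-sym Mz) KP.root)
        stay w (inj₁ h) (no a) (no b) = inj₁ (M-stays (component H W u u∈W) u∉ w h a b)
        stay w (inj₂ h) (no a) (no b) = inj₂ (M-stays (component H W z z∈W) z∉ w h a b)

      barrier : (T : VSet n) → count T ≤ suc k → (∀ t → t ∈ T → t ∈ X ⊎ t ∈ Y) →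
        (∀ w t → w ∈ P ∪ Q → Adj G w t → t ∈ X ⊎ t ∈ Y → t ∈ T) →
        (∀ t → t ∈ T → Σ (Fin n) λ y → Σ (y ∈ Y) λ h → ∃ λ c → c ∈ pocketC y h × Adj G t c) → Barrier k G u z
      barrier T size T⊆ into sees = record
        { T = T ; P = P ; Q = Q ; size = size ; u∈P = KP.root ; z∈Q = KQ.root
        ; P∩Q = λ w p q → Q∩P w q p ; P∩T = λ w p t → apart w (inj₁ p) (T⊆ w t) ; Q∩T = λ w q t → apart w (inj₂ q) (T⊆ w t)
        ; exitsP = λ w t h e → exits (λ i → into w t (inj₁ h) e i) (leaveP w t h e)
        ; exitsQ = λ w t h e → exits (λ i → into w t (inj₂ h) e i) (leaveQ w t h e)
        ; far = far ; even = even-PQ }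
        where
        apart : ∀ w → w ∈ P ∪ Q → ¬ (w ∈ X ⊎ w ∈ Y)
        apart w h (inj₁ x) = proj₁ (PQ⊆W w h) x
        apart w h (inj₂ y) = proj₂ (PQ⊆W w h) y
        exits : ∀ {A B D E : Set} → (B → E) → A ⊎ B ⊎ D → A ⊎ E ⊎ D
        exits f (inj₁ a) = inj₁ a
        exits f (inj₂ (inj₁ b)) = inj₂ (inj₁ (f b))
        exits f (inj₂ (inj₂ d)) = inj₂ (inj₂ d)
        far : ∀ t → t ∈ T → ∃ λ c → Adj G t c × (∀ w → w ∈ P ∪ Q → c ≢ w × ¬ Adj G w c)
        far t t∈T with sees t t∈T
        ... | y , h , c , c∈C , tc = c , tc , λ w w∈PQ →
          (λ { refl → PQ-avoids w w∈PQ y h c∈C }) ,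
          (λ wc → Pocket.exits′ (pockets y h) c w c∈C (Adj-sym G wc) (PQ-avoids w w∈PQ y h)
            (proj₁ (PQ⊆W w w∈PQ)) (λ { refl → proj₂ (PQ⊆W w w∈PQ) h }))

      own : ∀ y (h : y ∈ Y) → Σ (Fin n) λ y′ → Σ (y′ ∈ Y) λ h′ → ∃ λ c → c ∈ pocketC y′ h′ × Adj G y c
      own y h = y , h , M y , Pocket.c∈C (pockets y h) , proj₁ (proj₂ (M-ok y (proj₂ (proj₂ h))))

      -- By the number of common neighbours outside `X`: with none, `X` itself separates; a single
      -- one is added to `X`; of several, two suffice, since `two-pockets` leaves no edge from `X`
      -- to `P ∪ Q`, and 2 is at most k + 1.
      conclude : Fragment k G u z ⊎ Barrier k G u z
      conclude with any? (mem? Y)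
      ... | no none = inj₁ (record
        { F = P ; X = X ; size = ≤-reflexive |X| ; u∈F = KP.root ; v∉F = z∉P ; v∉X = z∉X
        ; disj = λ w h → proj₁ (KP.C⊆W w h) ; exits = exits })
        where
        exits : ∀ w t → w ∈ P → Adj G w t → t ∈ P ⊎ t ∈ X ⊎ (w ≡ u × t ≡ z)
        exits w t h e with leaveP w t h e
        ... | inj₁ a = inj₁ a
        ... | inj₂ (inj₁ (inj₁ a)) = inj₂ (inj₁ a)
        ... | inj₂ (inj₁ (inj₂ a)) = ⊥-elim (none (t , a))
        ... | inj₂ (inj₂ a) = inj₂ (inj₂ a)
      ... | yes (y₁ , y₁∈Y) with any? (mem? (Y ∖ ⁅ y₁ ⁆))
      ...   | no none = inj₂ (barrier (X ∪ ⁅ y₁ ⁆)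
        (≤-reflexive (trans (count-insert X y₁ (proj₂ (proj₂ y₁∈Y))) (cong suc |X|)))
        (λ { t (inj₁ x) → inj₁ x ; t (inj₂ refl) → inj₂ y₁∈Y }) into sees)
        where
        into : ∀ w t → w ∈ P ∪ Q → Adj G w t → t ∈ X ⊎ t ∈ Y → t ∈ X ∪ ⁅ y₁ ⁆
        into w t _ _ (inj₁ x) = inj₁ x
        into w t _ _ (inj₂ y) with t ≟ y₁
        ... | yes q = inj₂ q
        ... | no q  = ⊥-elim (none (t , y , q))
        sees : ∀ t → t ∈ X ∪ ⁅ y₁ ⁆ → Σ (Fin n) λ y → Σ (y ∈ Y) λ h → ∃ λ c → c ∈ pocketC y h × Adj G t c
        sees t (inj₁ x) = y₁ , y₁∈Y , pocket-sees y₁∈Y (pockets y₁ y₁∈Y) t x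
        sees t (inj₂ refl) = own y₁ y₁∈Y
      ...   | yes (y₂ , y₂∈Y , y₂≢y₁) = inj₂ (barrier (⁅ y₁ ⁆ ∪ ⁅ y₂ ⁆)
        (≤-trans (≤-reflexive (trans (count-insert ⁅ y₁ ⁆ y₂ y₂≢y₁) (cong suc (count-⁅⁆ y₁)))) (s≤s (proj₁ fc)))
        (λ { t (inj₁ refl) → inj₂ y₁∈Y ; t (inj₂ refl) → inj₂ y₂∈Y }) into
        (λ { t (inj₁ refl) → own y₁ y₁∈Y ; t (inj₂ refl) → own y₂ y₂∈Y }))
        where
        y₁≢y₂ : y₁ ≢ y₂
        y₁≢y₂ e = y₂≢y₁ (≡-sym e)
        pk₁ = pockets y₁ y₁∈Y
        pk₂ = pockets y₂ y₂∈Y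
        -- A third vertex of Y would give every x ∈ X neighbours in three disjoint pockets.
        into : ∀ w t → w ∈ P ∪ Q → Adj G w t → t ∈ X ⊎ t ∈ Y → t ∈ ⁅ y₁ ⁆ ∪ ⁅ y₂ ⁆
        into w t h e (inj₁ x) = ⊥-elim (two-pockets y₁∈Y y₂∈Y y₁≢y₂ pk₁ pk₂ t w x (Adj-sym G e)
          (PQ-avoids w h y₁ y₁∈Y) (PQ-avoids w h y₂ y₂∈Y) (proj₁ (PQ⊆W w h)) (proj₂ (PQ⊆W w h)))
        into w t h e (inj₂ y) with t ≟ y₁ | t ≟ y₂
        ... | yes q | _     = inj₁ q
        ... | no _  | yes q = inj₂ q
        ... | no t≢y₁ | no t≢y₂ with inhabited X (≤-trans (proj₁ fc) (≤-reflexive (≡-sym |X|)))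
        ...   | x , x∈X with pocket-sees y (refine y y₂∈Y t≢y₂ (refine y y₁∈Y t≢y₁ (pockets t y) pk₁) pk₂) x x∈X
        ...     | s , ((s∈C , s∉C₁) , s∉C₂) , xs = ⊥-elim (two-pockets y₁∈Y y₂∈Y y₁≢y₂ pk₁ pk₂ x s x∈X xs s∉C₁ s∉C₂
          (Pocket.C∩X (pockets t y) s s∈C) (λ s∈Y → Pocket.Y∩C (pockets t y) s s∈Y y s∈C))

  result : PerfectMatching H (∁ X) ⊎ Fragment k G u z ⊎ Barrier k G u z
  result with choose one
    where
    one : ∀ y → PerfectMatching H (∁ X) ⊎ (y ∈ Y → Pocket y)
    one y with mem? Y y
    ... | no ¬h = inj₂ (λ h → ⊥-elim (¬h h))
    ... | yes h = [ inj₁ , (λ pk → inj₂ (λ _ → pk)) ]′ (pocket y h)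
  ... | inj₁ p = inj₁ p
  ... | inj₂ pockets with mem? P z
  ...   | yes z∈P = inj₁ (Pockets.connected pockets z∈P)
  ...   | no z∉P  = inj₂ (Pockets.Disconnected.conclude pockets z∉P)

-- A matching that does not use `uz` survives the deletion, so `Core` is called only when `u` is
-- outside `X` and matched with `z`.
matching-or-barrier : ∀ {n k} (G : Graph n) → ClawFree G → FactorCritical k G → ∀ {u z H} → Deleted G u z H →
  (X : VSet n) → count X ≡ k → PerfectMatching H (∁ X) ⊎ Fragment k G u z ⊎ Barrier k G u z
matching-or-barrier G cf fc {u} {z} {H} del X |X| with fc-matching G fc X |X|
... | M , M-ok with mem? X u | M u ≟ z
...   | no u∉X | yes Mu = Core.result G cf fc del X |X| M M-ok u∉X
  (subst (_∉ X) Mu (proj₁ (M-ok u u∉X))) Mu (trans (cong M (≡-sym Mu)) (proj₂ (proj₂ (M-ok u u∉X))))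
...   | yes u∈X | _ = inj₁ (M , λ w w∉X → proj₁ (M-ok w w∉X) , edge w w∉X (M-ok w w∉X) , proj₂ (proj₂ (M-ok w w∉X)))
  where
  edge : ∀ w → w ∉ X → M w ∉ X × Adj G w (M w) × M (M w) ≡ w → Adj H w (M w)
  edge w w∉X (Mw∉X , e , MMw) with Deleted.above del e
  ... | inj₁ h = h
  ... | inj₂ (inj₁ (refl , _)) = ⊥-elim (w∉X u∈X)
  ... | inj₂ (inj₂ (_ , q)) = ⊥-elim (subst (_∉ X) q Mw∉X u∈X)
...   | no u∉X | no Mu≢z = inj₁ (M , λ w w∉X → proj₁ (M-ok w w∉X) , edge w (M-ok w w∉X) , proj₂ (proj₂ (M-ok w w∉X)))
  where
  edge : ∀ w → M w ∉ X × Adj G w (M w) × M (M w) ≡ w → Adj H w (M w)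
  edge w (Mw∉X , e , MMw) with Deleted.above del e
  ... | inj₁ h = h
  ... | inj₂ (inj₁ (refl , q)) = ⊥-elim (Mu≢z q)
  ... | inj₂ (inj₂ (p , q)) = ⊥-elim (Mu≢z (trans (cong M (≡-sym q)) (trans MMw p)))

-- The path `u`, `c`, `v` avoids the edge `uv`, so its middle vertex must be in the cut; likewise
-- for `common-in-barrier`.
common-in-cut : ∀ {n k} {G : Graph n} {u v} (f : Fragment k G u v) → ∀ c → Adj G u c → Adj G c v → c ∈ Fragment.X f
common-in-cut {G = G} {u} {v} f c uc cv with Fragment.exits f u c (Fragment.u∈F f) uc
... | inj₂ (inj₁ h) = h
... | inj₂ (inj₂ (_ , refl)) = ⊥-elim (Adj-irrefl G cv refl)
... | inj₁ h with Fragment.exits f c v h cv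
...   | inj₁ q = ⊥-elim (Fragment.v∉F f q)
...   | inj₂ (inj₁ q) = ⊥-elim (Fragment.v∉X f q)
...   | inj₂ (inj₂ (refl , _)) = ⊥-elim (Adj-irrefl G uc refl)

common-in-barrier : ∀ {n k} {G : Graph n} {u z} (b : Barrier k G u z) → ∀ c → Adj G u c → Adj G c z → c ∈ Barrier.T b
common-in-barrier {G = G} {u} {z} b c uc cz with Barrier.exitsP b u c (Barrier.u∈P b) uc
... | inj₂ (inj₁ h) = h
... | inj₂ (inj₂ (_ , refl)) = ⊥-elim (Adj-irrefl G cz refl)
... | inj₁ h with Barrier.exitsP b c z h cz
...   | inj₁ q = ⊥-elim (Barrier.P∩Q b z q (Barrier.z∈Q b))
...   | inj₂ (inj₁ q) = ⊥-elim (Barrier.Q∩T b z (Barrier.z∈Q b) q)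
...   | inj₂ (inj₂ (refl , _)) = ⊥-elim (Adj-irrefl G uc refl)

-- Barriers at an edge without a fragment

module Tight {n k : ℕ} (G : Graph n) (cf : ClawFree G) {u z : Fin n} (b : Barrier k G u z) (nf : ¬ Fragment k G u z) where
  open Barrier b

  |T| : count T ≡ suc k
  |T| = ≤-antisym size (≰⇒> (λ le → nf (record { F = P ; X = T ; size = le ; u∈F = u∈P ; v∉F = λ h → P∩Q z h z∈Q
    ; v∉X = Q∩T z z∈Q ; disj = P∩T ; exits = exitsP })))

  smaller : ∀ t → t ∈ T → count (T ∖ ⁅ t ⁆) ≤ k
  smaller t t∈T = ≤-pred (≤-trans (≤-reflexive (≡-sym (count-remove T t t∈T))) size)

  -- Otherwise `t` could be dropped from `T`, and the at most `k` vertices left would still cut off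
  -- `P`.
  touchesP : ∀ t → t ∈ T → ∃ λ a → a ∈ P × Adj G t a
  touchesP t t∈T with any? (λ a → mem? P a ×-dec Adj? G t a)
  ... | yes h = h
  ... | no ¬h = ⊥-elim (nf (record { F = P ; X = T ∖ ⁅ t ⁆ ; size = smaller t t∈T ; u∈F = u∈P ; v∉F = λ h → P∩Q z h z∈Q
    ; v∉X = λ h → Q∩T z z∈Q (proj₁ h) ; disj = λ w h q → P∩T w h (proj₁ q) ; exits = exits }))
    where
    exits : ∀ w s → w ∈ P → Adj G w s → s ∈ P ⊎ s ∈ T ∖ ⁅ t ⁆ ⊎ (w ≡ u × s ≡ z)
    exits w s w∈P e with exitsP w s w∈P e
    ... | inj₁ h = inj₁ h
    ... | inj₂ (inj₁ h) = inj₂ (inj₁ (h , λ { refl → ¬h (w , w∈P , Adj-sym G e) }))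
    ... | inj₂ (inj₂ h) = inj₂ (inj₂ h)

  touchesQ : ∀ t → t ∈ T → ∃ λ a → a ∈ Q × Adj G t a
  touchesQ t t∈T with any? (λ a → mem? Q a ×-dec Adj? G t a)
  ... | yes h = h
  ... | no ¬h = ⊥-elim (nf (flip-fragment (record { F = Q ; X = T ∖ ⁅ t ⁆ ; size = smaller t t∈T ; u∈F = z∈Q
    ; v∉F = P∩Q u u∈P ; v∉X = λ h → P∩T u u∈P (proj₁ h) ; disj = λ w h q → Q∩T w h (proj₁ q) ; exits = exits })))
    where
    exits : ∀ w s → w ∈ Q → Adj G w s → s ∈ Q ⊎ s ∈ T ∖ ⁅ t ⁆ ⊎ (w ≡ z × s ≡ u)
    exits w s w∈Q e with exitsQ w s w∈Q e
    ... | inj₁ h = inj₁ h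
    ... | inj₂ (inj₁ h) = inj₂ (inj₁ (h , λ { refl → ¬h (w , w∈Q , Adj-sym G e) }))
    ... | inj₂ (inj₂ h) = inj₂ (inj₂ h)

  -- The far neighbour of t turns any other pair of neighbours in P and Q into a claw.
  only : ∀ t a c → t ∈ T → a ∈ P → c ∈ Q → Adj G t a → Adj G t c → a ≡ u × c ≡ z
  only t a c t∈T a∈P c∈Q ta tc with far t t∈T
  ... | x , tx , x-far with clawFree-cases G cf t a c x tt tt tt tt ta tc tx (λ { refl → P∩Q a a∈P c∈Q })
          (λ e → proj₁ (x-far a (inj₁ a∈P)) (≡-sym e)) (λ e → proj₁ (x-far c (inj₂ c∈Q)) (≡-sym e))
  ...   | inj₂ (inj₁ ax) = ⊥-elim (proj₂ (x-far a (inj₁ a∈P)) ax)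
  ...   | inj₂ (inj₂ cx) = ⊥-elim (proj₂ (x-far c (inj₂ c∈Q)) cx)
  ...   | inj₁ ac with exitsP a c a∈P ac
  ...     | inj₁ h = ⊥-elim (P∩Q c h c∈Q)
  ...     | inj₂ (inj₁ h) = ⊥-elim (Q∩T c c∈Q h)
  ...     | inj₂ (inj₂ h) = h

  onlyP : ∀ t a → t ∈ T → a ∈ P → Adj G t a → a ≡ u
  onlyP t a t∈T a∈P ta with touchesQ t t∈T
  ... | c , c∈Q , tc = proj₁ (only t a c t∈T a∈P c∈Q ta tc)

  onlyQ : ∀ t c → t ∈ T → c ∈ Q → Adj G t c → c ≡ z
  onlyQ t c t∈T c∈Q tc with touchesP t t∈T
  ... | a , a∈P , ta = proj₂ (only t a c t∈T a∈P c∈Q ta tc)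

  T~u : ∀ t → t ∈ T → Adj G t u
  T~u t t∈T with touchesP t t∈T
  ... | a , a∈P , ta = subst (Adj G t) (onlyP t a t∈T a∈P ta) ta

  T~z : ∀ t → t ∈ T → Adj G t z
  T~z t t∈T with touchesQ t t∈T
  ... | c , c∈Q , tc = subst (Adj G t) (onlyQ t c t∈T c∈Q tc) tc

  -- By `onlyP` every edge leaving `P` starts at `u`, so `u` cuts off whatever else lies in `P`.
  innerP : ∀ w t → w ∈ P → w ≢ u → Adj G w t → t ∈ P
  innerP w t w∈P w≢u e with exitsP w t w∈P e
  ... | inj₁ h = h
  ... | inj₂ (inj₁ h) = ⊥-elim (w≢u (onlyP t w h w∈P (Adj-sym G e)))
  ... | inj₂ (inj₂ (q , _)) = ⊥-elim (w≢u q)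

  innerQ : ∀ w t → w ∈ Q → w ≢ z → Adj G w t → t ∈ Q
  innerQ w t w∈Q w≢z e with exitsQ w t w∈Q e
  ... | inj₁ h = h
  ... | inj₂ (inj₁ h) = ⊥-elim (w≢z (onlyQ t w h w∈Q (Adj-sym G e)))
  ... | inj₂ (inj₂ (q , _)) = ⊥-elim (w≢z q)

  member : ∃ λ t → t ∈ T
  member = inhabited T (≤-reflexive (≡-sym |T|))

-- The rest R of the graph outside the second barrier is odd, but Q minus z cuts it into two even parts.
crossing-barriers : ∀ {n} (G : Graph n) → ClawFree G → FactorCritical 1 G → ∀ {u z s₁ s₂} →
  (b : Barrier 1 G u z) → ¬ Fragment 1 G u z → (b′ : Barrier 1 G u s₁) → ¬ Fragment 1 G u s₁ →
  s₂ ∈ Barrier.T b → z ≢ s₂ → z ∈ Barrier.T b′ → s₂ ∈ Barrier.T b′ → ⊥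
crossing-barriers {n} G cf fc {u} {z} {s₁} {s₂} b nf b′ nf′ s₂∈T z≢s₂ z∈T′ s₂∈T′ =
  even-suc-odd (count (full ∖ ⁅ u ⁆)) even-rest (subst Even (count-remove full u tt) even-n)
  where
  open Barrier b
  open Tight G cf b nf
  module B′ = Barrier b′
  E S R W₁ W₂ : VSet n
  E = B′.P ∪ B′.Q
  S = E ∪ B′.T
  R = ∁ S
  W₁ = R ∩ (Q ∖ ⁅ z ⁆)
  W₂ = R ∖ (Q ∖ ⁅ z ⁆)

  T′⊆ : ∀ t → t ∈ B′.T → t ≡ z ⊎ t ≡ s₂
  T′⊆ t t∈T′ with t ≟ z | t ≟ s₂
  ... | yes q | _     = inj₁ q
  ... | no _  | yes q = inj₂ q
  ... | no t≢z | no t≢s₂ = ⊥-elim (<⇒≱ (s≤s (s≤s (count-positive (B′.T ∖ ⁅ z ⁆ ∖ ⁅ s₂ ⁆) t ((t∈T′ , t≢z) , t≢s₂))))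
    (≤-trans (≤-reflexive (≡-sym (trans (count-remove B′.T z z∈T′)
      (cong suc (count-remove (B′.T ∖ ⁅ z ⁆) s₂ (s₂∈T′ , λ e → z≢s₂ (≡-sym e))))))) B′.size))

  exitsR : ∀ w t → w ∈ R → Adj G w t → t ∈ R ⊎ t ≡ z ⊎ t ≡ s₂
  exitsR w t w∈R e with mem? S t
  ... | no h = inj₁ h
  ... | yes (inj₂ h) = inj₂ (T′⊆ t h)
  ... | yes (inj₁ (inj₁ h)) with B′.exitsP t w h (Adj-sym G e)
  ...   | inj₁ q = ⊥-elim (w∈R (inj₁ (inj₁ q)))
  ...   | inj₂ (inj₁ q) = ⊥-elim (w∈R (inj₂ q))
  ...   | inj₂ (inj₂ (_ , refl)) = ⊥-elim (w∈R (inj₁ (inj₂ B′.z∈Q)))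
  exitsR w t w∈R e | yes (inj₁ (inj₂ h)) with B′.exitsQ t w h (Adj-sym G e)
  ...   | inj₁ q = ⊥-elim (w∈R (inj₁ (inj₂ q)))
  ...   | inj₂ (inj₁ q) = ⊥-elim (w∈R (inj₂ q))
  ...   | inj₂ (inj₂ (_ , refl)) = ⊥-elim (w∈R (inj₁ (inj₁ B′.u∈P)))

  even₁ : Even (count W₁)
  even₁ = fc-even G fc ⁅ z ⁆ W₁ (count-⁅⁆ z) (λ v h → proj₂ (proj₂ h)) exits
    where
    exits : ∀ w t → w ∈ W₁ → Adj G w t → t ∈ W₁ ⊎ t ≡ z
    exits w t (w∈R , w∈Q , w≢z) e with exitsR w t w∈R e | t ≟ z
    ... | _ | yes q = inj₂ q
    ... | inj₁ h | no q = inj₁ (h , innerQ w t w∈Q w≢z e , q)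
    ... | inj₂ (inj₁ h) | no q = ⊥-elim (q h)
    ... | inj₂ (inj₂ refl) | no _ = ⊥-elim (Q∩T t (innerQ w t w∈Q w≢z e) s₂∈T)

  even₂ : Even (count W₂)
  even₂ = fc-even G fc ⁅ s₂ ⁆ W₂ (count-⁅⁆ s₂) (λ { v (v∈R , _) refl → v∈R (inj₂ s₂∈T′) }) exits
    where
    exits : ∀ w t → w ∈ W₂ → Adj G w t → t ∈ W₂ ⊎ t ≡ s₂
    exits w t (w∈R , w∉) e with exitsR w t w∈R e
    ... | inj₂ (inj₂ h) = inj₂ h
    ... | inj₁ h = inj₁ (h , λ { (t∈Q , t≢z) → w∉ (innerQ t w t∈Q t≢z (Adj-sym G e) , λ { refl → w∈R (inj₂ z∈T′) }) })
    -- A neighbour `w` of `z` lies in `Q`, is `u`, or lies in `T`; in the last case it is adjacent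
    -- to `u` and therefore in `S`.
    ... | inj₂ (inj₁ refl) with exitsQ z w z∈Q (Adj-sym G e)
    ...   | inj₁ h = ⊥-elim (w∉ (h , λ { refl → w∈R (inj₂ z∈T′) }))
    ...   | inj₂ (inj₂ (_ , refl)) = ⊥-elim (w∈R (inj₁ (inj₁ B′.u∈P)))
    ...   | inj₂ (inj₁ h) with B′.exitsP u w B′.u∈P (Adj-sym G (T~u w h))
    ...     | inj₁ q = ⊥-elim (w∈R (inj₁ (inj₁ q)))
    ...     | inj₂ (inj₁ q) = ⊥-elim (w∈R (inj₂ q))
    ...     | inj₂ (inj₂ (_ , refl)) = ⊥-elim (w∈R (inj₁ (inj₂ B′.z∈Q)))

  even-R : Even (count R)
  even-R = subst Even (≡-sym (count-⊎ R W₁ W₂ split (λ v → proj₁) (λ v → proj₁) (λ v p q → proj₂ q (proj₂ p))))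
    (even-+ (count W₁) (count W₂) even₁ even₂)
    where
    split : ∀ v → v ∈ R → v ∈ W₁ ⊎ v ∈ W₂
    split v v∈R with mem? (Q ∖ ⁅ z ⁆) v
    ... | yes h = inj₁ (v∈R , h)
    ... | no h  = inj₂ (v∈R , h)

  even-S : Even (count S)
  even-S = subst Even (≡-sym (count-⊎ S E B′.T (λ v → id) (λ v → inj₁) (λ v → inj₂)
      (λ { v (inj₁ p) → B′.P∩T v p ; v (inj₂ q) → B′.Q∩T v q })))
    (even-+ (count E) (count B′.T) B′.even (cong parity (Tight.|T| G cf b′ nf′)))

  even-n : Even (count (full {n}))
  even-n = subst Even (≡-sym (count-⊎ full S R split _ _ (λ v s r → r s))) (even-+ (count S) (count R) even-S even-R)
    where
    split : ∀ v → v ∈ full → v ∈ S ⊎ v ∈ R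
    split v _ with mem? S v
    ... | yes h = inj₁ h
    ... | no h  = inj₂ h

  even-rest : Even (count (full ∖ ⁅ u ⁆))
  even-rest = fc-even G fc ⁅ u ⁆ (full ∖ ⁅ u ⁆) (count-⁅⁆ u) (λ v → proj₂) exits
    where
    exits : ∀ w t → w ∈ full ∖ ⁅ u ⁆ → Adj G w t → t ∈ full ∖ ⁅ u ⁆ ⊎ t ≡ u
    exits w t _ _ with t ≟ u
    ... | yes q = inj₂ q
    ... | no q  = inj₁ (tt , q)

-- Consequences of minimality

minimal-edge : ∀ {n k} (G : Graph n) → ClawFree G → MinimalFactorCritical k G → ∀ {u z} → Adj G u z →
  ¬ Fragment k G u z → ¬ Barrier k G u z → ⊥
minimal-edge {n} {k} G cf (fc , minimal) {u} {z} uz nf nb = minimal u z uz (proj₁ fc , proj₁ (proj₂ fc) , matching)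
  where
  H : Graph n
  H = deleteEdge G u z uz
  matching : ∀ (X : Subset n) → ∣ X ∣ ≡ k → PerfectMatchingAvoiding H X
  -- A matching that cannot be repaired would give a fragment or a barrier, so otherwise `H` is
  -- still factor-critical.
  matching X |X| with matching-or-barrier G cf fc (deleteEdge-Deleted G u z uz) (fromSubset X) (trans (count-fromSubset X) |X|)
  ... | inj₂ (inj₁ f) = ⊥-elim (nf f)
  ... | inj₂ (inj₂ b) = ⊥-elim (nb b)
  ... | inj₁ (p , p-ok) = p , λ v v∉X → (λ h → proj₁ (p-ok v (λ q → v∉X (lookup⇒[]= v X q))) ([]=⇒lookup h))
                                         , proj₂ (p-ok v (λ q → v∉X (lookup⇒[]= v X q)))

-- Whether a fragment exists is never decided; the double negation is enough because every use ends
-- in a contradiction.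
fragment-at-induced-path : ∀ {n k} (G : Graph n) → ClawFree G → MinimalFactorCritical k G → ∀ {u z v} →
  Adj G u z → Adj G u v → ¬ Adj G z v → v ≢ z → ¬ ¬ Fragment k G u z
fragment-at-induced-path {n} {k} G cf mfc@(fc , _) {u} {z} {v} uz uv z≁v v≢z nf = minimal-edge G cf mfc uz nf no-barrier
  where
  no-barrier : ¬ Barrier k G u z
  no-barrier b = by k refl
    where
    open Barrier b
    open Tight G cf b nf
    v≢u : v ≢ u
    v≢u e = Adj-irrefl G uv (≡-sym e)
    v∈P : v ∈ P
    v∈P with exitsP u v u∈P uv
    ... | inj₁ h = h
    ... | inj₂ (inj₁ h) = ⊥-elim (z≁v (Adj-sym G (T~z v h)))
    ... | inj₂ (inj₂ (_ , h)) = ⊥-elim (v≢z h)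
    cut-vertex : 2 ≤ k → ⊥
    -- `u` alone cuts off the rest of `P` and no exceptional edge occurs: `v` and `z` merely mark
    -- the two sides.
    cut-vertex 2≤k = separation G fc (P ∖ ⁅ u ⁆) ⁅ u ⁆ v z (≤-trans (s≤s (≤-reflexive (count-⁅⁆ u))) 2≤k)
      (v∈P , v≢u) (λ h → P∩Q z (proj₁ h) z∈Q) (λ e → Adj-irrefl G uz (≡-sym e)) (λ w → proj₂) exits
      where
      exits : ∀ w t → w ∈ P ∖ ⁅ u ⁆ → Adj G w t → t ∈ P ∖ ⁅ u ⁆ ⊎ t ≡ u ⊎ (w ≡ v × t ≡ z)
      exits w t (w∈P , w≢u) e with t ≟ u
      ... | yes q = inj₂ (inj₁ q)
      ... | no q  = inj₁ (innerP w t w∈P w≢u e , q)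
    single : k ≡ 1 → ⊥
    single refl with member
    ... | s₁ , s₁∈T with inhabited (T ∖ ⁅ s₁ ⁆) (≤-pred (≤-reflexive (trans (≡-sym |T|) (count-remove T s₁ s₁∈T))))
    -- `z` and `s₂` are common neighbours of `u` and `s₁`: too many for the cut of a fragment when
    -- `k = 1`, and enough to fill a barrier.
    ...   | s₂ , s₂∈T , s₂≢s₁ = minimal-edge G cf mfc us₁ nf′ (λ b′ → crossing-barriers G cf fc b nf b′ nf′ s₂∈T z≢s₂
        (common-in-barrier b′ z uz (Adj-sym G (T~z s₁ s₁∈T))) (common-in-barrier b′ s₂ (Adj-sym G (T~u s₂ s₂∈T)) s₂s₁))
      where
      us₁ : Adj G u s₁
      us₁ = Adj-sym G (T~u s₁ s₁∈T)
      z≢s₂ : z ≢ s₂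
      z≢s₂ refl = Q∩T z z∈Q s₂∈T
      s₂s₁ : Adj G s₂ s₁
      -- By `onlyP`, `v` has no neighbour in `T`, so only this edge prevents a claw at `u`.
      s₂s₁ with clawFree-cases G cf u v s₂ s₁ tt tt tt tt uv (Adj-sym G (T~u s₂ s₂∈T)) us₁
                  (λ { refl → P∩T v v∈P s₂∈T }) (λ { refl → P∩T v v∈P s₁∈T }) s₂≢s₁
      ... | inj₁ h = ⊥-elim (v≢u (onlyP s₂ v s₂∈T v∈P (Adj-sym G h)))
      ... | inj₂ (inj₁ h) = ⊥-elim (v≢u (onlyP s₁ v s₁∈T v∈P (Adj-sym G h)))
      ... | inj₂ (inj₂ h) = h
      nf′ : ¬ Fragment 1 G u s₁
      nf′ f = <⇒≱ (s≤s (count-positive (X ∖ ⁅ z ⁆) s₂ (s₂∈X , λ e → z≢s₂ (≡-sym e))))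
        (≤-trans (≤-reflexive (≡-sym (count-remove X z z∈X))) (Fragment.size f))
        where
        open Fragment f using (X)
        z∈X = common-in-cut f z uz (Adj-sym G (T~z s₁ s₁∈T))
        s₂∈X = common-in-cut f s₂ (Adj-sym G (T~u s₂ s₂∈T)) s₂s₁
    by : ∀ j → k ≡ j → ⊥
    by zero          e = n≮0 (≤-trans (proj₁ fc) (≤-reflexive e))
    by (suc zero)    e = single e
    by (suc (suc j)) e = cut-vertex (≤-trans (s≤s (s≤s z≤n)) (≤-reflexive (≡-sym e)))

-- Uncrossing fragments

module Descent {n k : ℕ} (G : Graph n) (cf : ClawFree G) (mfc : MinimalFactorCritical k G)
  (large : ∀ v → suc k < count (neighbours G v)) where

  NoneSmaller : ℕ → Set₁
  NoneSmaller m = ∀ u v → Adj G u v → (f : Fragment k G u v) → count (Fragment.F f) < m → ⊥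

  -- Submodularity as in Halin's theorem on minimally connected graphs: with H the fragment of uz, minimality of F
  -- gives |X₂| > k, hence |X₃| < k, so the part Y of H outside F and X is empty, and then |H| < |F|.
  uncross : ∀ {u v z} → Adj G u z → (f : Fragment k G u v) → z ∈ Fragment.F f → Fragment k G u z →
    NoneSmaller (count (Fragment.F f)) → ⊥
  uncross {u} {v} {z} uz f z∈F g ih = ih u z uz g H<F
    where
    open Fragment f
    module g = Fragment g
    module f′ = Fragment (flip-fragment f)
    module g′ = Fragment (flip-fragment g)
    H X₁ F₂ X₂ X₃ Y : VSet n
    H = g.F
    X₁ = g.X
    -- `F₂` and `Y` are opposite corners of the crossing; `X₂` and `X₃` are the cuts around them.
    F₂ = F ∖ H ∖ X₁
    X₂ = (X ∖ H) ∪ (X₁ ∩ F)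
    X₃ = (X ∩ H) ∪ (X₁ ∖ F)
    Y = H ∖ (F ∪ X)

    split : ∀ (A B : VSet n) → count A ≡ count (A ∩ B) + count (A ∖ B)
    split A B = count-⊎ A (A ∩ B) (A ∖ B) cases (λ v → proj₁) (λ v → proj₁) (λ v p q → proj₂ q (proj₂ p))
      where
      cases : ∀ v → v ∈ A → v ∈ A ∩ B ⊎ v ∈ A ∖ B
      cases v a with mem? B v
      ... | yes h = inj₁ (a , h)
      ... | no h  = inj₂ (a , h)

    inner : k < count X₂
    inner with count X₂ ≤? k
    ... | no h = ≰⇒> h
    -- The corner `F₂` contains `z` but not `u`, so a small `X₂` would yield a fragment of the
    -- reversed edge smaller than `F`.
    ... | yes h = ⊥-elim (ih z u (Adj-sym G uz) (record { F = F₂ ; X = X₂ ; size = h ; u∈F = (z∈F , g.v∉F) , g.v∉X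
      ; v∉F = λ q → proj₂ (proj₁ q) g.u∈F
      ; v∉X = λ { (inj₁ (q , _)) → disj u u∈F q ; (inj₂ (q , _)) → g.disj u g.u∈F q }
      ; disj = λ { w ((w∈F , _) , _) (inj₁ (q , _)) → disj w w∈F q ; w (_ , w∉X₁) (inj₂ (q , _)) → w∉X₁ q }
      ; exits = exits₂ }) F₂<F)
      where
      F₂<F : count F₂ < count F
      F₂<F = ≤-trans (s≤s (count-mono F₂ (F ∖ ⁅ u ⁆) (λ { w ((w∈F , w∉H) , _) → w∈F , λ { refl → w∉H g.u∈F } })))
        (≤-reflexive (≡-sym (count-remove F u u∈F)))
      exits₂ : ∀ w t → w ∈ F₂ → Adj G w t → t ∈ F₂ ⊎ t ∈ X₂ ⊎ (w ≡ z × t ≡ u)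
      exits₂ w t ((w∈F , w∉H) , w∉X₁) e with exits w t w∈F e | g′.exits w t [ w∉H , w∉X₁ ]′ e
      ... | inj₂ (inj₂ (refl , _)) | _ = ⊥-elim (w∉H g.u∈F)
      ... | _ | inj₂ (inj₂ q) = inj₂ (inj₂ q)
      ... | inj₁ a | inj₁ q = inj₁ ((a , λ h → q (inj₁ h)) , λ h → q (inj₂ h))
      ... | inj₁ a | inj₂ (inj₁ q) = inj₂ (inj₁ (inj₂ (q , a)))
      ... | inj₂ (inj₁ a) | inj₁ q = inj₂ (inj₁ (inj₁ (a , λ h → q (inj₁ h))))
      ... | inj₂ (inj₁ a) | inj₂ (inj₁ q) = inj₂ (inj₁ (inj₁ (a , λ h → g.disj t h q)))

    X₂-bound : count X₂ ≤ count (X ∖ H) + count (X₁ ∩ F)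
    X₂-bound = count-∪-≤ X₂ (X ∖ H) (X₁ ∩ F) (λ w → id)

    X₃<k : count X₃ < k
    X₃<k = +-cancelˡ-≤ k (suc (count X₃)) k (begin
      k + suc (count X₃)    ≡⟨ +-suc k (count X₃) ⟩
      suc k + count X₃      ≤⟨ +-monoˡ-≤ (count X₃) inner ⟩
      count X₂ + count X₃   ≤⟨ +-mono-≤ X₂-bound (count-∪-≤ X₃ (X ∩ H) (X₁ ∖ F) (λ w → id)) ⟩
      (count (X ∖ H) + count (X₁ ∩ F)) + (count (X ∩ H) + count (X₁ ∖ F))
        ≡⟨ interchange (count (X ∖ H)) (count (X₁ ∩ F)) (count (X ∩ H)) (count (X₁ ∖ F)) ⟩
      (count (X ∖ H) + count (X ∩ H)) + (count (X₁ ∩ F) + count (X₁ ∖ F))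
        ≡⟨ cong₂ _+_ (trans (+-comm (count (X ∖ H)) (count (X ∩ H))) (≡-sym (split X H))) (≡-sym (split X₁ F)) ⟩
      count X + count X₁    ≤⟨ +-mono-≤ size g.size ⟩
      k + k                 ∎)
      where open ≤-Reasoning

    Y-empty : ∀ y → y ∉ Y
    Y-empty y y∈Y = by (mem? Y v)
      where
      exitsY : ∀ w t → w ∈ Y → Adj G w t → t ∈ Y ⊎ t ∈ X₃ ⊎ (w ≡ v × t ≡ u)
      exitsY w t (w∈H , w∉FX) e with f′.exits w t w∉FX e | g.exits w t w∈H e
      ... | inj₂ (inj₂ q) | _ = inj₂ (inj₂ q)
      ... | _ | inj₂ (inj₂ (refl , _)) = ⊥-elim (w∉FX (inj₁ u∈F))
      ... | inj₁ a | inj₁ q = inj₁ (q , a)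
      ... | inj₁ a | inj₂ (inj₁ q) = inj₂ (inj₁ (inj₂ (q , λ h → a (inj₁ h))))
      ... | inj₂ (inj₁ a) | inj₁ q = inj₂ (inj₁ (inj₁ (a , q)))
      ... | inj₂ (inj₁ a) | inj₂ (inj₁ q) = inj₂ (inj₁ (inj₂ (q , λ h → disj t h a)))
      separated : ∀ y₀ → y₀ ∈ Y → (∀ w → w ∈ Y → w ≡ v → w ≡ y₀) → ⊥
      separated y₀ y₀∈Y v-is = separation G (proj₁ mfc) Y X₃ y₀ u X₃<k y₀∈Y (λ h → proj₂ h (inj₁ u∈F))
        (λ { (inj₁ (q , _)) → disj u u∈F q ; (inj₂ (q , _)) → g.disj u g.u∈F q })
        (λ { w (_ , w∉FX) (inj₁ (q , _)) → w∉FX (inj₂ q) ; w (w∈H , _) (inj₂ (q , _)) → g.disj w w∈H q })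
        (λ w t w∈Y e → [ inj₁ , (λ r → inj₂ ([ inj₁ , (λ q → inj₂ (v-is w w∈Y (proj₁ q) , proj₂ q)) ]′ r)) ]′ (exitsY w t w∈Y e))
      -- Besides `X₃`, only the edge from `v` to `u` leaves `Y`. If `v` is not in `Y`, that exit
      -- never occurs and any `y` can take its place.
      by : Dec (v ∈ Y) → ⊥
      by (yes v∈Y) = separated v v∈Y (λ w _ q → q)
      by (no v∉Y)  = separated y y∈Y (λ { w w∈Y refl → ⊥-elim (v∉Y w∈Y) })

    H-bound : count H ≤ count (F ∩ H) + count (X ∩ H)
    H-bound = count-∪-≤ H (F ∩ H) (X ∩ H) cases
      where
      cases : ∀ w → w ∈ H → w ∈ F ∩ H ⊎ w ∈ X ∩ H
      cases w w∈H with mem? F w | mem? X w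
      ... | yes h | _     = inj₁ (h , w∈H)
      ... | no _  | yes h = inj₂ (h , w∈H)
      ... | no a  | no b  = ⊥-elim (Y-empty w (w∈H , [ a , b ]′))

    H<F : count H < count F
    -- `F` splits into `F ∩ H`, the part of `F ∖ H` in `X₁`, and `F₂`; the vertex `z` of `F₂`
    -- supplies the strict inequality.
    H<F = +-cancelʳ-≤ (count X₂) (suc (count H)) (count F) (begin
      suc (count H) + count X₂  ≡⟨ +-comm 1 (count H + count X₂) ⟩
      (count H + count X₂) + 1
        ≤⟨ +-mono-≤ (+-mono-≤ H-bound (≤-trans X₂-bound (+-monoʳ-≤ (count (X ∖ H)) X₁F)))
                    (count-positive F₂ z ((z∈F , g.v∉F) , g.v∉X)) ⟩
      ((FH + XH) + (XnH + FX₁)) + count F₂    ≡⟨ +-assoc (FH + XH) (XnH + FX₁) (count F₂) ⟩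
      (FH + XH) + ((XnH + FX₁) + count F₂)
        ≡⟨ cong (FH + XH +_) (trans (+-assoc XnH FX₁ (count F₂)) (+-comm XnH (FX₁ + count F₂))) ⟩
      (FH + XH) + ((FX₁ + count F₂) + XnH)    ≡⟨ interchange FH XH (FX₁ + count F₂) XnH ⟩
      (FH + (FX₁ + count F₂)) + (XH + XnH)
        ≡⟨ cong₂ _+_ (trans (cong (FH +_) (≡-sym (split (F ∖ H) X₁))) (≡-sym (split F H))) (≡-sym (split X H)) ⟩
      count F + count X         ≤⟨ +-monoʳ-≤ (count F) (≤-trans size (<⇒≤ inner)) ⟩
      count F + count X₂        ∎)
      where
      open ≤-Reasoning
      FH XH XnH FX₁ : ℕ
      FH  = count (F ∩ H)
      XH  = count (X ∩ H)
      XnH = count (X ∖ H)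
      FX₁ = count ((F ∖ H) ∩ X₁)
      X₁F : count (X₁ ∩ F) ≤ FX₁
      X₁F = count-mono (X₁ ∩ F) ((F ∖ H) ∩ X₁) (λ { w (a , b) → (b , λ h → g.disj w h a) , a })

  -- Of the at least k + 2 neighbours of `u`, at most `k` lie in `X` and at most one is `v`.
  neighbour-inside : ∀ {u v} (f : Fragment k G u v) → ∃ λ z → z ∈ Fragment.F f × Adj G u z
  neighbour-inside {u} {v} f with any? (λ z → mem? (Fragment.F f) z ×-dec Adj? G u z)
  ... | yes h = h
  ... | no ¬h = ⊥-elim (<⇒≱ (large u) (≤-trans (count-∪-≤ (neighbours G u) X ⁅ v ⁆ cases)
      (≤-trans (+-mono-≤ size (≤-reflexive (count-⁅⁆ v))) (≤-reflexive (+-comm k 1)))))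
    where
    open Fragment f
    cases : ∀ t → Adj G u t → t ∈ X ⊎ t ≡ v
    cases t ut with exits u t u∈F ut
    ... | inj₁ h = ⊥-elim (¬h (t , h , ut))
    ... | inj₂ (inj₁ h) = inj₁ h
    ... | inj₂ (inj₂ (_ , h)) = inj₂ h

  no-fragment : ∀ m → NoneSmaller m
  no-fragment (suc m) u v uv f (s≤s le) with neighbour-inside f
  -- Edges from `F` to `v` start only at `u`, so `v`, `u`, `z` is an induced path and `uz` has a
  -- fragment too.
  ... | z , z∈F , uz = fragment-at-induced-path G cf mfc uz uv z≁v (λ { refl → v∉F z∈F })
      (λ g → uncross uz f z∈F g (λ u′ v′ e f′ lt → no-fragment m u′ v′ e f′ (≤-trans lt le)))
    where
    open Fragment f
    z≁v : ¬ Adj G z v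
    z≁v e with exits z v z∈F e
    ... | inj₁ h = v∉F h
    ... | inj₂ (inj₁ h) = v∉X h
    ... | inj₂ (inj₂ (refl , _)) = Adj-irrefl G uz refl

  no-fragment-at : ∀ {u v} → Adj G u v → ¬ Fragment k G u v
  no-fragment-at {u} {v} e f = no-fragment (suc (count (Fragment.F f))) u v e f ≤-refl

  -- Without fragments, `uz` must have a barrier. A vertex `s` of it is adjacent to `u` and to a far
  -- vertex `c` not adjacent to `u`; this induced path demands a fragment after all.
  no-edge : ∀ u z → ¬ Adj G u z
  no-edge u z uz = minimal-edge G cf mfc uz (no-fragment-at uz) no-barrier
    where
    no-barrier : ¬ Barrier k G u z
    no-barrier b with Tight.member G cf b (no-fragment-at uz)
    ... | s , s∈T with Barrier.far b s s∈T
    ...   | c , sc , c-far = fragment-at-induced-path G cf mfc su sc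
        (proj₂ (c-far u (inj₁ (Barrier.u∈P b)))) (proj₁ (c-far u (inj₁ (Barrier.u∈P b)))) (no-fragment-at su)
      where
      su : Adj G s u
      su = Tight.T~u G cf b (no-fragment-at uz) s s∈T

-- Lower bound on degrees and the theorem

degree-bound : ∀ {n k} (G : Graph n) → FactorCritical k G → ∀ v → suc k ≤ count (neighbours G v)
degree-bound {n} {k} G fc v with suc k ≤? count (neighbours G v)
... | yes h = h
-- With at most `k` neighbours, some set `B` of size `k` contains them all but not `v`, which then
-- cannot be matched.
... | no ¬h with superset-of-size (neighbours G v) (full ∖ ⁅ v ⁆) k (λ { w e → tt , λ { refl → Adj-irrefl G e refl } })
    (≤-pred (≰⇒> ¬h))
    (≤-pred (≤-trans (proj₁ (proj₂ fc)) (≤-reflexive (trans (≡-sym (count-full n)) (count-remove full v tt)))))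
... | B , N⊆B , B⊆U , |B| with fc-matching G fc B |B|
... | p , p-ok with p-ok v (λ h → proj₂ (B⊆U v h) refl)
... | pv∉B , e , _ = ⊥-elim (pv∉B (N⊆B (p v) e))

theorem1p4 : (k n : ℕ) → 1 ≤ k → (G : Graph n) →
    ClawFree G → MinimalFactorCritical k G → MinDegreeIs G (suc k)
theorem1p4 k n 1≤k G cf mfc@(fc , _) = lower , attained
  where
  lower : ∀ v → suc k ≤ degree G v
  lower v = ≤-trans (degree-bound G fc v) (≤-reflexive (≡-sym (degree≡count G v)))
  attained : ∃ λ v → degree G v ≡ suc k
  attained with any? (λ v → degree G v ≟ℕ suc k)
  ... | yes h = h
  -- If no degree equals k + 1, all are larger and `Descent.no-edge` forbids edges; yet there is a
  -- vertex, and by the lower bound it has a neighbour.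
  ... | no ¬h with inhabited (full {n}) (≤-trans (proj₁ (proj₂ fc)) (≤-reflexive (≡-sym (count-full n))))
  ...   | u , _ with inhabited (neighbours G u) (degree-bound G fc u)
  ...     | z , uz = ⊥-elim (Descent.no-edge G cf mfc large u z uz)
    where
    large : ∀ v → suc k < count (neighbours G v)
    large v = ≤∧≢⇒< (degree-bound G fc v) (λ e → ¬h (v , trans (degree≡count G v) (≡-sym e)))
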